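{- Let $n$ be a positive integer, let $p\ge q$ be positive integers, and let $B$ be a $p\times q$ matrix. For each positive divisor $k$ of $n$, let $F_k$ be the symmetric block matrix of size $kq+\frac{n}{k}p$ whose block rows and columns have sizes, in order, $p$, then $q$ repeated $k$ times, then $p$ repeated $\frac{n}{k}-1$ times; the block in a size-$p$ block row and a size-$q$ block column is $B$, the block in a size-$q$ block row and a size-$p$ block column is $B^T$, and all other blocks are zero. That is, $$F_k=\begin{bmatrix} 0 & B & \cdots & B & 0 & \cdots & 0\\ B^T & 0 & \cdots & 0 & B^T & \cdots & B^T\\ \vdots & \vdots & \ddots & \vdots & \vdots & \ddots & \vdots\\ B^T & 0 & \cdots & 0 & B^T & \cdots & B^T\\ 0 & B & \cdots & B & 0 & \cdots & 0\\ \vdots & \vdots & \ddots & \vdots & \vdots & \ddots & \vdots\\ 0 & B & \cdots & B & 0 & \cdots & 0\end{bmatrix}.$$ Then the matrices $F_k\oplus 0_{(n-\frac{n}{k})p+(1-k)q}$, as $k$ ranges over all positive divisors of $n$, are pairwise cospectral.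
   Context: For matrices $X,Y$, $X\oplus Y=\begin{bmatrix} X&0\\0&Y\end{bmatrix}$; $0_m$ is the $m\times m$ zero matrix. Two square matrices are cospectral if they have the same eigenvalues with the same multiplicities. -}

module Defs where

open import Algebra.Apartness.Bundles using (HeytingField; HeytingCommutativeRing)
open import Algebra.Bundles using (RawRing; CommutativeRing)
open import Algebra.Morphism.Structures using (IsRingHomomorphism)
import Algebra.Definitions.RawSemiring as RawSemiringDefs
open import Data.Bool.Base using (if_then_else_)
open import Data.Fin.Base using (Fin; zero; suc; toℕ; splitAt; remQuot; punchIn)
open import Data.Fin.Properties using (_≟_)
open import Data.List.Base using (List; []; _∷_; map; foldr)
open import Data.Nat.Base using (ℕ; zero; suc; NonZero) renaming (_+_ to _+ℕ_; _*_ to _*ℕ_; _∸_ to _∸ℕ_)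
open import Data.Nat.DivMod using (_/_)
open import Data.Product.Base using (Σ-syntax; ∃-syntax; _×_; proj₂)
open import Data.Sum.Base using (_⊎_; inj₁; inj₂; [_,_]′)
open import Data.Vec.Functional using (Vector)
open import Function.Bundles using (_⇔_)
open import Level using (Level; _⊔_) renaming (suc to lsuc)
open import Relation.Nullary.Decidable.Core using (does)

private
  variable
    a c ℓ ℓ₁ ℓ₂ : Level

-- "x ≠ y" is the apartness x # y, so that ℝ and ℂ are covered and equality
-- need not be decidable. The second component says that each integer
-- multiple of 1 is zero or nonzero; classically this holds in every field,
-- and constructively it holds in ℚ, ℝ, ℂ and every field with decidable
-- equality. (0 # 1 follows from the axioms of HeytingField.)
record Field c ℓ₁ ℓ₂ : Set (lsuc (c ⊔ ℓ₁ ⊔ ℓ₂)) where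
  field
    heytingField : HeytingField c ℓ₁ ℓ₂

  open HeytingField heytingField public

  commutativeRing : CommutativeRing c ℓ₁
  commutativeRing = HeytingCommutativeRing.commutativeRing heytingCommutativeRing

  rawRing : RawRing c ℓ₁
  rawRing = CommutativeRing.rawRing commutativeRing

  open RawSemiringDefs (RawRing.rawSemiring rawRing) public
    using (sum) renaming (_×_ to _·_)

  field
    ℕ-zero-or-apart : ∀ (m : ℕ) → (m · 1# ≈ 0#) ⊎ (m · 1# # 0#)

-- Homomorphisms of fields are automatically injective, so these are exactly
-- the field extensions L of K.
record Extension (K L : Field c ℓ₁ ℓ₂) : Set (c ⊔ ℓ₁ ⊔ ℓ₂) where
  field
    embed              : Field.Carrier K → Field.Carrier L
    isRingHomomorphism : IsRingHomomorphism (Field.rawRing K) (Field.rawRing L) embed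

Matrix : Set a → ℕ → ℕ → Set a
Matrix A m n = Vector (Vector A n) m

mapᴹ : ∀ {A : Set a} {B : Set ℓ} {m n} → (A → B) → Matrix A m n → Matrix B m n
mapᴹ f A i j = f (A i j)

module _ (R : RawRing c ℓ) where
  open RawRing R
  open RawSemiringDefs rawSemiring using (sum; _^_)

  -- Laplace expansion along the first row.
  det : ∀ {n} → Matrix Carrier n n → Carrier
  det {zero}  A = 1#
  det {suc n} A = sum λ j →
    ((- 1#) ^ toℕ j) * (A zero j * det (λ i k → A (suc i) (punchIn j k)))

module Polynomial (R : RawRing c ℓ) where
  open RawRing R

  -- Coefficients, constant term first; trailing zeros are allowed.
  Poly : Set c
  Poly = List Carrier

  coeff : Poly → ℕ → Carrier
  coeff []      _       = 0#
  coeff (x ∷ p) zero    = x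
  coeff (x ∷ p) (suc i) = coeff p i

  _+ᴾ_ : Poly → Poly → Poly
  []      +ᴾ q       = q
  (x ∷ p) +ᴾ []      = x ∷ p
  (x ∷ p) +ᴾ (y ∷ q) = (x + y) ∷ (p +ᴾ q)

  _*ᴾ_ : Poly → Poly → Poly
  []      *ᴾ q = []
  (x ∷ p) *ᴾ q = map (x *_) q +ᴾ (0# ∷ (p *ᴾ q))

  polyRawRing : RawRing c ℓ
  polyRawRing = record
    { Carrier = Poly
    ; _≈_     = λ p q → ∀ i → coeff p i ≈ coeff q i
    ; _+_     = _+ᴾ_
    ; _*_     = _*ᴾ_
    ; -_      = map (-_)
    ; 0#      = []
    ; 1#      = 1# ∷ []
    }

  X : Poly
  X = 0# ∷ 1# ∷ []

  const : Carrier → Poly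
  const x = x ∷ []

  eval : Poly → Carrier → Carrier
  eval p x = foldr (λ b r → b + x * r) 0# p

module _ (K : Field c ℓ₁ ℓ₂) where
  open Field K
  open Polynomial rawRing
  private
    module P = RawRing polyRawRing
  open RawSemiringDefs P.rawSemiring using () renaming (_^_ to _^ᴾ_)

  charPoly : ∀ {n} → Matrix Carrier n n → Poly
  charPoly A = det polyRawRing λ i j →
    (if does (i ≟ j) then X else P.0#) P.+ (P.- const (A i j))

  IsEigenvalue : ∀ {n} → Matrix Carrier n n → Carrier → Set (c ⊔ ℓ₁ ⊔ ℓ₂)
  IsEigenvalue {n} A e =
    Σ[ v ∈ Vector Carrier n ] (∃[ i ] v i # 0#) × (∀ i → sum (λ j → A i j * v j) ≈ e * v i)

  -- Algebraic multiplicity: charPoly A = (X - e)ᵐ g with g(e) ≠ 0.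
  HasMultiplicity : ∀ {n} → Matrix Carrier n n → Carrier → ℕ → Set (c ⊔ ℓ₁ ⊔ ℓ₂)
  HasMultiplicity A e m =
    ∃[ g ] (charPoly A P.≈ (((X P.+ (P.- const e)) ^ᴾ m) P.* g)) × (eval g e # 0#)

  SameEigenvalues : ∀ {m n} → Matrix Carrier m m → Matrix Carrier n n → Set (c ⊔ ℓ₁ ⊔ ℓ₂)
  SameEigenvalues A A′ = ∀ e →
      (IsEigenvalue A e ⇔ IsEigenvalue A′ e)
    × (∀ k → HasMultiplicity A e k ⇔ HasMultiplicity A′ e k)

-- The eigenvalues of a matrix over K need not lie in K, hence the
-- quantification over all extensions L of K (L = K included).
Cospectral : (K : Field c ℓ₁ ℓ₂) → let open Field K in
             ∀ {m n} → Matrix Carrier m m → Matrix Carrier n n → Set (lsuc (c ⊔ ℓ₁ ⊔ ℓ₂))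
Cospectral {c} {ℓ₁} {ℓ₂} K A A′ =
  ∀ (L : Field c ℓ₁ ℓ₂) (φ : Extension K L) →
  let open Extension φ in SameEigenvalues L (mapᴹ embed A) (mapᴹ embed A′)

-- Block sizes in order: p, then k times q, then l - 1 times p.
sizeF : (p q k l : ℕ) → ℕ
sizeF p q k l = p +ℕ (k *ℕ q +ℕ (l ∸ℕ 1) *ℕ p)

-- The position of an index inside its block, which has size p (inj₁) or
-- size q (inj₂).
position : ∀ p q k l → Fin (sizeF p q k l) → Fin p ⊎ Fin q
position p q k l i =
  [ inj₁
  , (λ i′ → [ (λ j → inj₂ (proj₂ (remQuot {k} q j)))
            , (λ j → inj₁ (proj₂ (remQuot {l ∸ℕ 1} p j)))
            ]′ (splitAt (k *ℕ q) i′))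
  ]′ (splitAt p i)

-- (n - n/k) p + (1 - k) q. For k ∣ n and q ≤ p this is
-- (k - 1)((n/k) p - q) ≥ 0, so the subtractions are not truncated.
padding : (p q n k : ℕ) .{{_ : NonZero k}} → ℕ
padding p q n k = ((n ∸ℕ n / k) *ℕ p +ℕ q) ∸ℕ k *ℕ q

module _ (K : Field c ℓ₁ ℓ₂) where
  open Field K

  0ᴹ : ∀ m → Matrix Carrier m m
  0ᴹ m i j = 0#

  infixr 6 _⊕_
  _⊕_ : ∀ {m n} → Matrix Carrier m m → Matrix Carrier n n → Matrix Carrier (m +ℕ n) (m +ℕ n)
  _⊕_ {m} A A′ i j with splitAt m i | splitAt m j
  ... | inj₁ i₁ | inj₁ j₁ = A i₁ j₁
  ... | inj₂ i₂ | inj₂ j₂ = A′ i₂ j₂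
  ... | inj₁ _  | inj₂ _  = 0#
  ... | inj₂ _  | inj₁ _  = 0#

  F : ∀ {p q} → Matrix Carrier p q → (n k : ℕ) .{{_ : NonZero k}} →
      Matrix Carrier (sizeF p q k (n / k)) (sizeF p q k (n / k))
  F {p} {q} B n k i j with position p q k (n / k) i | position p q k (n / k) j
  ... | inj₁ x | inj₂ y = B x y
  ... | inj₂ y | inj₁ x = B x y
  ... | inj₁ _ | inj₁ _ = 0#
  ... | inj₂ _ | inj₂ _ = 0#

  F⊕0 : ∀ {p q} → Matrix Carrier p q → (n k : ℕ) .{{_ : NonZero k}} →
        let size = sizeF p q k (n / k) +ℕ padding p q n k in Matrix Carrier size size
  F⊕0 {p} {q} B n k = F B n k ⊕ 0ᴹ (padding p q n k)

{-# OPTIONS --safe #-}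
-- Write l = n / k and G = [0 B; Bᵀ 0] on p + q indices. Row i of F_k ⊕ 0 is a copy of a row of G, or zero in the
-- padding, and likewise for columns, so F_k ⊕ 0 = U V where V sums the coordinates in each class and U spreads
-- the rows of G; moreover V U = W G with W = diag(l, ..., l, k, ..., k). Sylvester's identity
-- x^r det(x - U V) = x^N det(x - V U) followed by a Schur complement gives
--   X^q X^(p+q) χ(F_k ⊕ 0) = X^(np+q) X^p det(X² - n Bᵀ B),
-- whose right-hand side does not depend on k, and X can be cancelled.
--
-- Constructively a vanishing determinant yields no eigenvector, so eigenvectors are transported directly. For k ≠ k′
-- we have n ≥ 2, hence N = np + q > p + q and 0 is an eigenvalue by the pigeonhole principle. If n = 0 in the field,
-- then (F_k ⊕ 0)³ = 0 and 0 is the only eigenvalue. If n ≠ 0, then V maps an eigenvector v to an eigenvector of W G,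
-- which can be rescaled to one of W′ G and lifted to F_k′ ⊕ 0, unless V v = 0, and then the eigenvalue is 0.
module Submission where

open import Defs
open import Algebra.Bundles using (CommutativeRing)
open import Algebra.Morphism.Structures using (IsRingHomomorphism)
open import Data.Bool.Base using (if_then_else_)
open import Data.Fin.Base using (Fin; zero; suc; toℕ; fromℕ<; inject₁; punchIn; punchOut; splitAt; join;
  remQuot; _↑ˡ_; _↑ʳ_)
open import Data.Fin.Induction using (<-weakInduction)
open import Data.Fin.Properties using (_≟_; <⇒≢; pigeonhole; punchIn-injective; punchIn-punchOut;
  punchInᵢ≢i; splitAt-↑ˡ; splitAt-↑ʳ; toℕ-inject₁; toℕ-↑ˡ)
open import Data.List.Base using ([]; map) renaming (_∷_ to _∷ᴸ_)
open import Data.Maybe.Base using (Maybe; just; nothing; fromMaybe)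
open import Data.Nat.Base using (ℕ; zero; suc; NonZero; _∸_; _≤_; _<_; ≢-nonZero; ≢-nonZero⁻¹; >-nonZero⁻¹)
  renaming (_+_ to _+ℕ_; _*_ to _*ℕ_)
open import Data.Nat.DivMod using (_/_; m/n*n≡m)
open import Data.Nat.Divisibility using (_∣_; ∣1⇒≡1)
import Data.Nat.Properties as ℕ
open import Data.Nat.Solver using (module +-*-Solver)
open import Data.Product.Base using (∃₂; ∃-syntax; _×_; _,_; proj₁; proj₂)
open import Data.Sum.Base using (_⊎_; inj₁; inj₂; [_,_]′) renaming (map to map⊎)
open import Data.Vec.Functional using (Vector; _∷_; tail; insertAt)
open import Data.Vec.Functional.Properties using (insertAt-lookup; insertAt-punchIn)
open import Function.Base using (_∘_; const; id)
open import Function.Bundles using (mk⇔)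
open import Level using (_⊔_)
open import Relation.Binary.PropositionalEquality as ≡ using (_≡_; _≢_)
open import Relation.Nullary using (yes; no; does; contradiction)
open import Relation.Nullary.Decidable using (dec-true; dec-false)

-- The entries of a characteristic matrix are polynomials, so determinants are studied over an
-- arbitrary commutative ring, starting from the first-row expansion alone. Multiplicativity and
-- invariance under transposition both come from one fact: a function of square matrices that is
-- linear in each row and vanishes when two adjacent rows agree is its value at the identity times
-- the determinant. Schur complements are therefore taken by multiplying with a block matrix whose
-- determinant is a power of X, and this is where the extra powers of X come from. The weights l and
-- k enter the Schur complement only through lk = n. The same relation gives W G W = n G, hence the
-- vanishing cube when n = 0, and makes diag(l′, l) intertwine W G with W′ G, since lk = l′k′.
-- Whether V v is zero cannot be decided. Instead a coordinate of v that is apart from 0 is written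
-- as a sum of two terms, and cotransitivity tells which of the two is apart from 0.

-- Adjacent indices and deletion of an index.

data Adjacent : ∀ {n} → Fin n → Fin n → Set where
  here  : ∀ {n} → Adjacent {suc (suc n)} zero (suc zero)
  there : ∀ {n} {i j : Fin n} → Adjacent i j → Adjacent (suc i) (suc j)

inject₁-adjacent : ∀ {n} (i : Fin n) → Adjacent (inject₁ i) (suc i)
inject₁-adjacent zero    = here
inject₁-adjacent (suc i) = there (inject₁-adjacent i)

adjacent⇒≢ : ∀ {n} {i j : Fin n} → Adjacent i j → i ≢ j
adjacent⇒≢ here ()
adjacent⇒≢ (there adj) ≡.refl = adjacent⇒≢ adj ≡.refl

adjacent-toℕ : ∀ {n} {i j : Fin n} → Adjacent i j → toℕ j ≡ suc (toℕ i)
adjacent-toℕ here        = ≡.refl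
adjacent-toℕ (there adj) = ≡.cong suc (adjacent-toℕ adj)

-- Deleting one of two neighbours or the other leaves the same sequence of indices, except in the
-- single slot where the surviving neighbour sits. Minors that delete one of two equal adjacent rows
-- therefore agree.
punchIn-adjacent : ∀ {n} {i j : Fin (suc n)} → Adjacent i j → ∀ k →
  punchIn i k ≡ punchIn j k ⊎ (punchIn i k ≡ j × punchIn j k ≡ i)
punchIn-adjacent here zero           = inj₂ (≡.refl , ≡.refl)
punchIn-adjacent here (suc k)        = inj₁ ≡.refl
punchIn-adjacent (there adj) zero    = inj₁ ≡.refl
punchIn-adjacent (there adj) (suc k) with punchIn-adjacent adj k
... | inj₁ eq        = inj₁ (≡.cong suc eq)
... | inj₂ (eq , eq′) = inj₂ (≡.cong suc eq , ≡.cong suc eq′)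

-- A third index cannot lie between two neighbours, so they stay neighbours when it is deleted. This
-- lets alternation on adjacent rows pass to minors.
adjacent-punchIn : ∀ {n} {i j k : Fin (suc n)} → Adjacent i j → k ≢ i → k ≢ j →
  ∃₂ λ i′ j′ → Adjacent i′ j′ × punchIn k i′ ≡ i × punchIn k j′ ≡ j
adjacent-punchIn {k = zero} here k≢i k≢j = contradiction ≡.refl k≢i
adjacent-punchIn {k = suc zero} here k≢i k≢j = contradiction ≡.refl k≢j
adjacent-punchIn {suc (suc n)} {k = suc (suc k)} here k≢i k≢j = zero , suc zero , here , ≡.refl , ≡.refl
adjacent-punchIn {k = zero} (there adj) k≢i k≢j = _ , _ , adj , ≡.refl , ≡.refl
adjacent-punchIn {suc n} {k = suc k} (there adj) k≢i k≢j
  with adjacent-punchIn adj (k≢i ∘ ≡.cong suc) (k≢j ∘ ≡.cong suc)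
... | i′ , j′ , adj′ , eq , eq′ = suc i′ , suc j′ , there adj′ , ≡.cong suc eq , ≡.cong suc eq′

-- With the next two lemmas: the orderings "j first, then all other indices" for two consecutive
-- values of j differ by one transposition. This is the induction step of `alternating-cycle`.
punchIn-inject₁-self : ∀ {n} (i : Fin n) → punchIn (inject₁ i) i ≡ suc i
punchIn-inject₁-self zero    = ≡.refl
punchIn-inject₁-self (suc i) = ≡.cong suc (punchIn-inject₁-self i)

punchIn-suc-self : ∀ {n} (i : Fin n) → punchIn (suc i) i ≡ inject₁ i
punchIn-suc-self zero    = ≡.refl
punchIn-suc-self (suc i) = ≡.cong suc (punchIn-suc-self i)

punchIn-inject₁-suc : ∀ {n} {i j : Fin n} → j ≢ i → punchIn (suc i) j ≡ punchIn (inject₁ i) j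
punchIn-inject₁-suc {i = zero}  {zero}  j≢i = contradiction ≡.refl j≢i
punchIn-inject₁-suc {i = zero}  {suc j} j≢i = ≡.refl
punchIn-inject₁-suc {i = suc i} {zero}  j≢i = ≡.refl
punchIn-inject₁-suc {i = suc i} {suc j} j≢i = ≡.cong suc (punchIn-inject₁-suc (j≢i ∘ ≡.cong suc))

data PunchView {n} (j : Fin (suc n)) : Fin (suc n) → Set where
  same    : PunchView j j
  punched : ∀ k → PunchView j (punchIn j k)

punchView : ∀ {n} (j k : Fin (suc n)) → PunchView j k
punchView j k with j ≟ k
... | yes ≡.refl = same
... | no j≢k = ≡.subst (PunchView j) (punchIn-punchOut j≢k) (punched (punchOut j≢k))

-- Matrices and finite sums over a commutative ring.

module MatrixRing {c ℓ} (R : CommutativeRing c ℓ) where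
  open CommutativeRing R hiding (zero)
  open import Algebra.Properties.Semiring.Sum semiring public
    using (sum; sum-cong-≋; sum-replicate-zero; ∑-distrib-+; ∑-comm; *-distribˡ-sum; *-distribʳ-sum)
  open import Algebra.Properties.Semiring.Exp semiring public using (_^_)
  open import Algebra.Properties.Ring ring using (-1*x≈-x; -‿involutive; -0#≈0#; +-inverseˡ-unique)
  open import Algebra.Properties.CommutativeSemigroup *-commutativeSemigroup using (x∙yz≈y∙xz)
  open import Relation.Binary.Reasoning.Setoid setoid

  infix 4 _≋_
  _≋_ : ∀ {m n} → Matrix Carrier m n → Matrix Carrier m n → Set ℓ
  A ≋ B = ∀ i j → A i j ≈ B i j

  infix 10 _ᵀ
  _ᵀ : ∀ {m n} → Matrix Carrier m n → Matrix Carrier n m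
  (A ᵀ) i j = A j i

  infixl 7 _⊗_
  _⊗_ : ∀ {m n o} → Matrix Carrier m n → Matrix Carrier n o → Matrix Carrier m o
  (A ⊗ B) i k = sum λ j → A i j * B j k

  -- Written as in `charPoly`, so that the characteristic polynomial unfolds to the determinant of
  -- `scalar X` minus the matrix of constants, with no rewriting.
  scalar : ∀ {n} → Carrier → Matrix Carrier n n
  scalar x i j = if does (i ≟ j) then x else 0#

  sum-cong : ∀ {n} {f g : Vector Carrier n} → (∀ i → f i ≈ g i) → sum f ≈ sum g
  sum-cong = sum-cong-≋

  sum-zero : ∀ {n} {f : Vector Carrier n} → (∀ i → f i ≈ 0#) → sum f ≈ 0#
  sum-zero {n} f≈0 = trans (sum-cong f≈0) (sum-replicate-zero n)

  scalar-diagonal : ∀ {n} x (i : Fin n) → scalar x i i ≡ x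
  scalar-diagonal x i = ≡.cong (λ b → if b then x else 0#) (dec-true (i ≟ i) ≡.refl)

  scalar-off-diagonal : ∀ {n} x {i j : Fin n} → i ≢ j → scalar x i j ≡ 0#
  scalar-off-diagonal x {i} {j} i≢j = ≡.cong (λ b → if b then x else 0#) (dec-false (i ≟ j) i≢j)

  scalar-sym : ∀ {n} x (i j : Fin n) → scalar x i j ≡ scalar x j i
  scalar-sym x i j with i ≟ j
  ... | yes ≡.refl = ≡.sym (scalar-diagonal x i)
  ... | no  i≢j    = ≡.sym (scalar-off-diagonal x (i≢j ∘ ≡.sym))

  sum-scalarˡ : ∀ {n} x (i : Fin n) (f : Vector Carrier n) → sum (λ j → scalar x i j * f j) ≈ x * f i
  sum-scalarˡ x zero    f = trans (+-congˡ (sum-zero λ j → zeroˡ (f (suc j)))) (+-identityʳ _)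
  sum-scalarˡ x (suc i) f = trans (+-cong (zeroˡ _) (sum-scalarˡ x i (f ∘ suc))) (+-identityˡ _)

  sum-scalarʳ : ∀ {n} x (i : Fin n) (f : Vector Carrier n) → sum (λ j → f j * scalar x j i) ≈ f i * x
  sum-scalarʳ x i f = begin
    sum (λ j → f j * scalar x j i)  ≈⟨ sum-cong (λ j → trans (*-comm _ _) (*-congʳ (reflexive (scalar-sym x j i)))) ⟩
    sum (λ j → scalar x i j * f j)  ≈⟨ sum-scalarˡ x i f ⟩
    x * f i                         ≈⟨ *-comm x (f i) ⟩
    f i * x                         ∎

  sum-adjacent : ∀ {n} {i j : Fin n} → Adjacent i j → {f : Vector Carrier n} →
    f i + f j ≈ 0# → (∀ k → k ≢ i → k ≢ j → f k ≈ 0#) → sum f ≈ 0#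
  sum-adjacent here {f} fi+fj≈0 f≈0 = begin
    f zero + (f (suc zero) + sum (λ k → f (suc (suc k))))  ≈⟨ +-assoc _ _ _ ⟨
    (f zero + f (suc zero)) + sum (λ k → f (suc (suc k)))  ≈⟨ +-cong fi+fj≈0 (sum-zero {f = λ k → f (suc (suc k))}
                                                                λ k → f≈0 (suc (suc k)) (λ ()) (λ ())) ⟩
    0# + 0#                                                ≈⟨ +-identityˡ 0# ⟩
    0#                                                     ∎
  sum-adjacent (there adj) {f} fi+fj≈0 f≈0 = begin
    f zero + sum (f ∘ suc)  ≈⟨ +-cong (f≈0 zero (λ ()) (λ ())) (sum-adjacent adj fi+fj≈0
                                 (λ k k≢i k≢j → f≈0 (suc k) (λ { ≡.refl → k≢i ≡.refl }) (λ { ≡.refl → k≢j ≡.refl }))) ⟩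
    0# + 0#                 ≈⟨ +-identityˡ 0# ⟩
    0#                      ∎

  -- Alternating functions of the rows and their uniqueness.

  AgreeOff : ∀ {m n} → Fin m → Matrix Carrier m n → Matrix Carrier m n → Set ℓ
  AgreeOff i A B = ∀ r → r ≢ i → ∀ j → A r j ≈ B r j

  -- One law, C = A + x B in row i, covers additivity and homogeneity at once. Alternation is asked
  -- for adjacent rows only, because that is the form which an induction over minors can establish.
  record IsAlternating {m n} (Δ : Matrix Carrier m n → Carrier) : Set (c ⊔ ℓ) where
    field
      Δ-cong      : ∀ {A B} → A ≋ B → Δ A ≈ Δ B
      linear      : ∀ i x {A B C} → AgreeOff i C A → AgreeOff i C B →
                    (∀ j → C i j ≈ A i j + x * B i j) → Δ C ≈ Δ A + x * Δ B
      alternating : ∀ {i i′} A → Adjacent i i′ → (∀ j → A i j ≈ A i′ j) → Δ A ≈ 0#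

    -- A zero row equals itself minus itself, so linearity with `A` in all three places and x = -1
    -- gives Δ A - Δ A.
    zero-row : ∀ A i → (∀ j → A i j ≈ 0#) → Δ A ≈ 0#
    zero-row A i Ai≈0 = begin
      Δ A                ≈⟨ linear i (- 1#) (λ _ _ _ → refl) (λ _ _ _ → refl) (λ j → begin
                              A i j                    ≈⟨ Ai≈0 j ⟩
                              0#                       ≈⟨ -‿inverseʳ (A i j) ⟨
                              A i j - A i j            ≈⟨ +-congˡ (-1*x≈-x (A i j)) ⟨
                              A i j + - 1# * A i j     ∎) ⟩
      Δ A + - 1# * Δ A   ≈⟨ +-congˡ (-1*x≈-x (Δ A)) ⟩
      Δ A - Δ A          ≈⟨ -‿inverseʳ (Δ A) ⟩
      0#                 ∎

    additive : ∀ i {A B C} → AgreeOff i C A → AgreeOff i C B →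
               (∀ j → C i j ≈ A i j + B i j) → Δ C ≈ Δ A + Δ B
    additive i {A} {B} {C} C≈A C≈B Ci≈ = trans
      (linear i 1# C≈A C≈B (λ j → trans (Ci≈ j) (+-congˡ (sym (*-identityˡ _)))))
      (+-congˡ (*-identityˡ _))

    Vanishes : Fin m → Fin m → Set (c ⊔ ℓ)
    Vanishes i i′ = ∀ A → (∀ j → A i j ≈ A i′ j) → Δ A ≈ 0#

    module Replace {i i′ : Fin m} (i≢i′ : i ≢ i′) (A : Matrix Carrier m n) where
      rows : Vector Carrier n → Vector Carrier n → Matrix Carrier m n
      rows u v r = if does (r ≟ i) then u else if does (r ≟ i′) then v else A r

      rows-i : ∀ u v j → rows u v i j ≈ u j
      rows-i u v j rewrite dec-true (i ≟ i) ≡.refl = refl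

      rows-i′ : ∀ u v j → rows u v i′ j ≈ v j
      rows-i′ u v j rewrite dec-false (i′ ≟ i) (i≢i′ ∘ ≡.sym) | dec-true (i′ ≟ i′) ≡.refl = refl

      rows-off : ∀ u v {r} → r ≢ i → r ≢ i′ → ∀ j → rows u v r j ≈ A r j
      rows-off u v {r} r≢i r≢i′ j rewrite dec-false (r ≟ i) r≢i | dec-false (r ≟ i′) r≢i′ = refl

      rows-agree-i : ∀ u u′ v → AgreeOff i (rows u v) (rows u′ v)
      rows-agree-i u u′ v r r≢i j rewrite dec-false (r ≟ i) r≢i = refl

      rows-agree-i′ : ∀ u v v′ → AgreeOff i′ (rows u v) (rows u v′)
      rows-agree-i′ u v v′ r r≢i′ j rewrite dec-false (r ≟ i′) r≢i′ = refl

      rows-self : ∀ {B u v} → (∀ j → B i j ≈ u j) → (∀ j → B i′ j ≈ v j) →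
                  (∀ r → r ≢ i → r ≢ i′ → ∀ j → B r j ≈ A r j) → B ≋ rows u v
      rows-self {B} {u} {v} Bi Bi′ Br r j with r ≟ i
      ... | yes ≡.refl = Bi j
      ... | no r≢i with r ≟ i′
      ...   | yes ≡.refl = Bi′ j
      ...   | no r≢i′    = Br r r≢i r≢i′ j

      additive-i : ∀ u u′ v → Δ (rows (λ j → u j + u′ j) v) ≈ Δ (rows u v) + Δ (rows u′ v)
      additive-i u u′ v = additive i (rows-agree-i _ _ v) (rows-agree-i _ _ v) λ j →
        trans (rows-i _ v j) (sym (+-cong (rows-i u v j) (rows-i u′ v j)))

      additive-i′ : ∀ u v v′ → Δ (rows u (λ j → v j + v′ j)) ≈ Δ (rows u v) + Δ (rows u v′)
      additive-i′ u v v′ = additive i′ (rows-agree-i′ u _ _) (rows-agree-i′ u _ _) λ j →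
        trans (rows-i′ u _ j) (sym (+-cong (rows-i′ u v j) (rows-i′ u v′ j)))

      vanishes-rows : Vanishes i i′ → ∀ u → Δ (rows u u) ≈ 0#
      vanishes-rows vanishes u = vanishes (rows u u) λ j → trans (rows-i u u j) (sym (rows-i′ u u j))

    -- Polarisation: put the sum of both rows into both places and expand. Two of the four terms
    -- have equal rows and vanish, so the other two are negatives of each other. Vanishing is a
    -- hypothesis on the pair, because it is known for adjacent pairs before others.
    swap : ∀ {i i′} → i ≢ i′ → Vanishes i i′ → ∀ A B → (∀ j → B i j ≈ A i′ j) → (∀ j → B i′ j ≈ A i j) →
           (∀ r → r ≢ i → r ≢ i′ → ∀ j → B r j ≈ A r j) → Δ B ≈ - Δ A
    swap {i} {i′} i≢i′ vanishes A B Bi Bi′ Br = begin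
      Δ B         ≈⟨ Δ-cong (rows-self Bi Bi′ Br) ⟩
      Δ (rows v u) ≈⟨ +-inverseˡ-unique _ _ (begin
        Δ (rows v u) + Δ (rows u v)   ≈⟨ +-cong (+-identityʳ _) (+-identityˡ _) ⟨
        (Δ (rows v u) + 0#) + (0# + Δ (rows u v)) ≈⟨ +-cong (+-congˡ (vanishes-rows vanishes v)) (+-congʳ (vanishes-rows vanishes u)) ⟨
        (Δ (rows v u) + Δ (rows v v)) + (Δ (rows u u) + Δ (rows u v)) ≈⟨ +-cong (additive-i′ v u v) (additive-i′ u u v) ⟨
        Δ (rows v s) + Δ (rows u s)   ≈⟨ +-comm _ _ ⟩
        Δ (rows u s) + Δ (rows v s)   ≈⟨ additive-i u v s ⟨
        Δ (rows s s)                  ≈⟨ vanishes-rows vanishes s ⟩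
        0#                            ∎) ⟩
      - Δ (rows u v) ≈⟨ -‿cong (Δ-cong (rows-self (λ _ → refl) (λ _ → refl) (λ _ _ _ _ → refl))) ⟨
      - Δ A       ∎
      where
      open Replace i≢i′ A
      u v s : Vector Carrier n
      u = A i
      v = A i′
      s j = u j + v j

  -- Induction on the distance: swapping two adjacent rows moves the copy of row 0 one place closer
  -- to row 0, at the cost of a sign.
  vanishes-zero-suc : ∀ {m n} {Δ : Matrix Carrier (suc m) n → Carrier} (alt : IsAlternating Δ) →
    ∀ i → IsAlternating.Vanishes alt zero (suc i)
  vanishes-zero-suc {suc m} {n} {Δ} alt =
    <-weakInduction (λ i → Vanishes zero (suc i)) (λ A → alternating A here) step
    where
    open IsAlternating alt
    step : ∀ i → Vanishes zero (suc (inject₁ i)) → Vanishes zero (suc (suc i))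
    step i vanishes A A0≈ = begin
      Δ A      ≈⟨ -‿involutive (Δ A) ⟨
      - - Δ A  ≈⟨ -‿cong (swap i≢ (λ A′ → alternating A′ adj) A B (rows-i v u) (rows-i′ v u)
                    (λ r → rows-off v u {r})) ⟨
      - Δ B    ≈⟨ -‿cong (vanishes B λ j → trans (rows-off v u {zero} (λ ()) (λ ()) j)
                    (trans (A0≈ j) (sym (rows-i v u j)))) ⟩
      - 0#     ≈⟨ -0#≈0# ⟩
      0#       ∎
      where
      adj : Adjacent (suc (inject₁ i)) (suc (suc i))
      adj = there (inject₁-adjacent i)
      i≢ : suc (inject₁ i) ≢ suc (suc i)
      i≢ = adjacent⇒≢ adj
      open Replace i≢ A
      u v : Vector Carrier n
      u = A (suc (inject₁ i))
      v = A (suc (suc i))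
      B : Matrix Carrier (suc (suc m)) n
      B = rows v u

  module _ {m n} {Δ : Matrix Carrier (suc m) n → Carrier} (alt : IsAlternating Δ) where
    open IsAlternating alt

    ∷-agreeOff : ∀ (u v : Vector Carrier n) (A : Matrix Carrier m n) → AgreeOff zero (u ∷ A) (v ∷ A)
    ∷-agreeOff u v A zero    0≢0 = contradiction ≡.refl 0≢0
    ∷-agreeOff u v A (suc i) _ j = refl

    ∷-cong : ∀ {u v} {A B : Matrix Carrier m n} → (∀ j → u j ≈ v j) → A ≋ B → Δ (u ∷ A) ≈ Δ (v ∷ B)
    ∷-cong u≈v A≋B = Δ-cong λ { zero → u≈v ; (suc i) → A≋B i }

    linear-sum : ∀ {o} (x : Vector Carrier o) (u : Matrix Carrier o n) (A : Matrix Carrier m n) →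
      Δ ((λ j → sum λ k → x k * u k j) ∷ A) ≈ sum λ k → x k * Δ (u k ∷ A)
    linear-sum {zero}  x u A = zero-row _ zero (λ _ → refl)
    linear-sum {suc o} x u A = begin
      Δ ((λ j → sum λ k → x k * u k j) ∷ A)
        ≈⟨ linear zero (x zero) (∷-agreeOff _ _ A) (∷-agreeOff _ _ A) (λ j → +-comm _ _) ⟩
      Δ ((λ j → sum λ k → x (suc k) * u (suc k) j) ∷ A) + x zero * Δ (u zero ∷ A)
        ≈⟨ +-comm _ _ ⟩
      x zero * Δ (u zero ∷ A) + Δ ((λ j → sum λ k → x (suc k) * u (suc k) j) ∷ A)
        ≈⟨ +-congˡ (linear-sum (x ∘ suc) (u ∘ suc) A) ⟩
      sum (λ k → x k * Δ (u k ∷ A)) ∎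

    -- The rows are changed one after another. Each change adds a multiple of Δ at a matrix in which
    -- row 0 is repeated.
    add-first-row : ∀ u (x : Vector Carrier m) (A : Matrix Carrier m n) →
      Δ (u ∷ A) ≈ Δ (u ∷ λ i j → A i j + x i * u j)
    add-first-row u x A = add-each (λ A → Δ (u ∷ A)) (λ A≋B → ∷-cong (λ _ → refl) A≋B) invariant x A
      where
      invariant : ∀ i y A B → AgreeOff i B A → (∀ j → B i j ≈ A i j + y * u j) → Δ (u ∷ A) ≈ Δ (u ∷ B)
      invariant i y A B B≈A Bi = sym (begin
        Δ (u ∷ B)                  ≈⟨ linear (suc i) y {u ∷ A} {u ∷ A′}
                                        (λ { zero _ j → refl ; (suc r) r≢i → B≈A r (r≢i ∘ ≡.cong suc) })
                                        (λ { zero _ j → refl ; (suc r) r≢i j → trans (B≈A r (r≢i ∘ ≡.cong suc) j)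
                                               (sym (reflexive (≡.cong-app (A′-off (r≢i ∘ ≡.cong suc)) j))) })
                                        (λ j → trans (Bi j) (+-congˡ (*-congˡ (sym (reflexive (≡.cong-app A′-i j)))))) ⟩
        Δ (u ∷ A) + y * Δ (u ∷ A′) ≈⟨ +-congˡ (*-congˡ (vanishes-zero-suc alt i (u ∷ A′)
                                        (λ j → sym (reflexive (≡.cong-app A′-i j))))) ⟩
        Δ (u ∷ A) + y * 0#         ≈⟨ +-congˡ (zeroʳ y) ⟩
        Δ (u ∷ A) + 0#             ≈⟨ +-identityʳ _ ⟩
        Δ (u ∷ A)                  ∎)
        where
        A′ : Matrix Carrier m n
        A′ r = if does (r ≟ i) then u else A r
        A′-i : A′ i ≡ u
        A′-i rewrite dec-true (i ≟ i) ≡.refl = ≡.refl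
        A′-off : ∀ {r} → r ≢ i → A′ r ≡ A r
        A′-off {r} r≢i rewrite dec-false (r ≟ i) r≢i = ≡.refl

      -- Stated for any `f` that tolerates a change of a single row. The recursion can then absorb
      -- the rows already treated into `f`.
      add-each : ∀ {o} (f : Matrix Carrier o n → Carrier) → (∀ {A B} → A ≋ B → f A ≈ f B) →
        (∀ i y A B → AgreeOff i B A → (∀ j → B i j ≈ A i j + y * u j) → f A ≈ f B) →
        ∀ (x : Vector Carrier o) A → f A ≈ f λ i j → A i j + x i * u j
      add-each {zero}  f f-cong inv x A = f-cong λ ()
      add-each {suc o} f f-cong inv x A = begin
        f A                         ≈⟨ inv zero (x zero) A (a ∷ tail A)
                                         (λ { zero 0≢0 → contradiction ≡.refl 0≢0 ; (suc r) _ j → refl }) (λ _ → refl) ⟩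
        f (a ∷ tail A)              ≈⟨ add-each (λ A → f (a ∷ A))
                                         (λ A≋B → f-cong λ { zero _ → refl ; (suc i) → A≋B i })
                                         (λ i y A B B≈A Bi → inv (suc i) y (a ∷ A) (a ∷ B)
                                            (λ { zero _ _ → refl ; (suc r) r≢i → B≈A r (r≢i ∘ ≡.cong suc) }) Bi)
                                         (x ∘ suc) (tail A) ⟩
        f (a ∷ λ i j → A (suc i) j + x (suc i) * u j)
                                    ≈⟨ f-cong (λ { zero _ → refl ; (suc i) _ → refl }) ⟩
        f (λ i j → A i j + x i * u j) ∎
        where
        a : Vector Carrier n
        a j = A zero j + x zero * u j

  insertColumn : ∀ {m n} → Fin (suc n) → Matrix Carrier m n → Matrix Carrier m (suc n)
  insertColumn j A i = insertAt (A i) j 0#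

  insertColumn-same : ∀ {m n} j (A : Matrix Carrier m n) i → insertColumn j A i j ≈ 0#
  insertColumn-same j A i = reflexive (insertAt-lookup (A i) j 0#)

  insertColumn-punchIn : ∀ {m n} j (A : Matrix Carrier m n) i k → insertColumn j A i (punchIn j k) ≈ A i k
  insertColumn-punchIn j A i k = reflexive (insertAt-punchIn (A i) j 0# k)

  -- Under a fixed first row e_j and with a zero column j, an alternating function becomes one of
  -- the n by n minor: row i of the minor is row i + 1 below, and adjacency is preserved. This
  -- drives the induction in `alternating-unique`.
  minor-isAlternating : ∀ {n} {Δ : Matrix Carrier (suc n) (suc n) → Carrier} → IsAlternating Δ →
    ∀ j → IsAlternating (λ A → Δ (scalar 1# j ∷ insertColumn j A))
  minor-isAlternating {n} {Δ} alt j = record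
    { Δ-cong = λ A≋B → ∷-cong alt (λ _ → refl) (λ i → insert-cong (A≋B i))
    ; linear = λ i x C≈A C≈B Ci≈ → linear (suc i) x
        (λ { zero _ _ → refl ; (suc r) r≢i → insert-cong (C≈A r (r≢i ∘ ≡.cong suc)) })
        (λ { zero _ _ → refl ; (suc r) r≢i → insert-cong (C≈B r (r≢i ∘ ≡.cong suc)) })
        (insert-linear Ci≈)
    ; alternating = λ A adj A≈ → alternating _ (there adj) (insert-cong A≈)
    }
    where
    open IsAlternating alt
    insert-cong : ∀ {u v : Vector Carrier n} → (∀ k → u k ≈ v k) → ∀ k → insertAt u j 0# k ≈ insertAt v j 0# k
    insert-cong {u} {v} u≈v k with punchView j k
    ... | same      = reflexive (≡.trans (insertAt-lookup u j 0#) (≡.sym (insertAt-lookup v j 0#)))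
    ... | punched k = trans (reflexive (insertAt-punchIn u j 0# k))
                        (trans (u≈v k) (sym (reflexive (insertAt-punchIn v j 0# k))))
    insert-linear : ∀ {u v w : Vector Carrier n} {x} → (∀ k → w k ≈ u k + x * v k) →
      ∀ k → insertAt w j 0# k ≈ insertAt u j 0# k + x * insertAt v j 0# k
    insert-linear {u} {v} {w} {x} w≈ k with punchView j k
    ... | same rewrite insertAt-lookup u j 0# | insertAt-lookup v j 0# | insertAt-lookup w j 0# =
      sym (trans (+-identityˡ _) (zeroʳ x))
    ... | punched k rewrite insertAt-punchIn u j 0# k | insertAt-punchIn v j 0# k | insertAt-punchIn w j 0# k = w≈ k

  -- The matrix is the identity with row j moved to the front. It is reached by j swaps, each
  -- exchanging row 0 with the next row further down, and these produce the sign in the Laplace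
  -- expansion.
  alternating-cycle : ∀ {n} {Δ : Matrix Carrier (suc n) (suc n) → Carrier} → IsAlternating Δ →
    ∀ j → Δ (scalar 1# j ∷ λ i → scalar 1# (punchIn j i)) ≈ (- 1#) ^ toℕ j * Δ (scalar 1#)
  alternating-cycle {n} {Δ} alt = <-weakInduction
    (λ j → Δ (E j) ≈ (- 1#) ^ toℕ j * Δ (scalar 1#))
    (trans (Δ-cong (λ { zero _ → refl ; (suc i) _ → refl })) (sym (*-identityˡ _)))
    λ j Δ≈ → begin
      Δ (E (suc j))                                ≈⟨ swap (λ ()) (vanishes-zero-suc alt j) (E (inject₁ j)) (E (suc j))
                                                        (λ k → reflexive (≡.cong (λ i → scalar 1# i k) (≡.sym (punchIn-inject₁-self j))))
                                                        (λ k → reflexive (≡.cong (λ i → scalar 1# i k) (punchIn-suc-self j)))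
                                                        (λ { zero 0≢0 _ → contradiction ≡.refl 0≢0
                                                           ; (suc i) _ i≢j k → reflexive (≡.cong (λ i → scalar 1# i k)
                                                               (punchIn-inject₁-suc (i≢j ∘ ≡.cong suc))) }) ⟩
      - Δ (E (inject₁ j))                          ≈⟨ -‿cong Δ≈ ⟩
      - ((- 1#) ^ toℕ (inject₁ j) * Δ (scalar 1#)) ≈⟨ -‿cong (*-congʳ (reflexive (≡.cong ((- 1#) ^_) (toℕ-inject₁ j)))) ⟩
      - ((- 1#) ^ toℕ j * Δ (scalar 1#))           ≈⟨ -1*x≈-x _ ⟨
      - 1# * ((- 1#) ^ toℕ j * Δ (scalar 1#))      ≈⟨ *-assoc _ _ _ ⟨
      (- 1#) ^ suc (toℕ j) * Δ (scalar 1#)         ∎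
    where
    open IsAlternating alt
    E : Fin (suc n) → Matrix Carrier (suc n) (suc n)
    E j = scalar 1# j ∷ λ i → scalar 1# (punchIn j i)

  -- Expanding row 0 by linearity and clearing column j below the unit row e_j gives the Laplace recursion of det.
  alternating-unique : ∀ {n} {Δ : Matrix Carrier n n → Carrier} → IsAlternating Δ →
    ∀ A → Δ A ≈ Δ (scalar 1#) * det rawRing A
  alternating-unique {zero}  {Δ} alt A = trans (IsAlternating.Δ-cong alt λ ()) (sym (*-identityʳ _))
  alternating-unique {suc n} {Δ} alt A = begin
    Δ A
      ≈⟨ Δ-cong (λ { zero j → sym (trans (sum-scalarʳ 1# j (A zero)) (*-identityʳ _)) ; (suc i) _ → refl }) ⟩
    Δ ((λ k → sum λ j → A zero j * scalar 1# j k) ∷ tail A)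
      ≈⟨ linear-sum alt (A zero) (scalar 1#) (tail A) ⟩
    sum (λ j → A zero j * Δ (scalar 1# j ∷ tail A))
      ≈⟨ sum-cong term ⟩
    sum (λ j → Δ (scalar 1#) * ((- 1#) ^ toℕ j * (A zero j * d j)))
      ≈⟨ *-distribˡ-sum (Δ (scalar 1#)) (λ j → (- 1#) ^ toℕ j * (A zero j * d j)) ⟨
    Δ (scalar 1#) * det rawRing A ∎
    where
    open IsAlternating alt
    minor : Fin (suc n) → Matrix Carrier n n
    minor j i k = A (suc i) (punchIn j k)
    d : Fin (suc n) → Carrier
    d j = det rawRing (minor j)
    clear : ∀ j i k → A (suc i) k + (- A (suc i) j) * scalar 1# j k ≈ insertColumn j (minor j) i k
    clear j i k with punchView j k
    ... | same      = begin
      A (suc i) j + (- A (suc i) j) * scalar 1# j j  ≈⟨ +-congˡ (trans (*-congˡ (reflexive (scalar-diagonal 1# j))) (*-identityʳ _)) ⟩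
      A (suc i) j - A (suc i) j                      ≈⟨ -‿inverseʳ _ ⟩
      0#                                             ≈⟨ insertColumn-same j (minor j) i ⟨
      insertColumn j (minor j) i j                   ∎
    ... | punched k = begin
      A (suc i) (punchIn j k) + (- A (suc i) j) * scalar 1# j (punchIn j k)
        ≈⟨ +-congˡ (trans (*-congˡ (reflexive (scalar-off-diagonal 1# (punchInᵢ≢i j k ∘ ≡.sym)))) (zeroʳ _)) ⟩
      minor j i k + 0#                               ≈⟨ +-identityʳ _ ⟩
      minor j i k                                    ≈⟨ insertColumn-punchIn j (minor j) i k ⟨
      insertColumn j (minor j) i (punchIn j k)       ∎
    unit : ∀ j i k → insertColumn j (scalar 1#) i k ≈ scalar 1# (punchIn j i) k
    unit j i k with punchView j k
    ... | same      = trans (insertColumn-same j (scalar 1#) i) (sym (reflexive (scalar-off-diagonal 1# (punchInᵢ≢i j i))))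
    ... | punched k = trans (insertColumn-punchIn j (scalar 1#) i k) (reflexive (scalar-punchIn j i k))
      where
      scalar-punchIn : ∀ {n} j (i k : Fin n) → scalar 1# i k ≡ scalar 1# (punchIn j i) (punchIn j k)
      scalar-punchIn zero    i       k       = ≡.refl
      scalar-punchIn (suc j) zero    zero    = ≡.refl
      scalar-punchIn (suc j) zero    (suc k) = ≡.refl
      scalar-punchIn (suc j) (suc i) zero    = ≡.refl
      scalar-punchIn (suc j) (suc i) (suc k) = scalar-punchIn j i k
    term : ∀ j → A zero j * Δ (scalar 1# j ∷ tail A) ≈ Δ (scalar 1#) * ((- 1#) ^ toℕ j * (A zero j * d j))
    term j = begin
      A zero j * Δ (scalar 1# j ∷ tail A)
        ≈⟨ *-congˡ (add-first-row alt (scalar 1# j) (λ i → - A (suc i) j) (tail A)) ⟩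
      A zero j * Δ (scalar 1# j ∷ λ i k → A (suc i) k + (- A (suc i) j) * scalar 1# j k)
        ≈⟨ *-congˡ (∷-cong alt (λ _ → refl) (clear j)) ⟩
      A zero j * Δ (scalar 1# j ∷ insertColumn j (minor j))
        ≈⟨ *-congˡ (alternating-unique (minor-isAlternating alt j) (minor j)) ⟩
      A zero j * (Δ (scalar 1# j ∷ insertColumn j (scalar 1#)) * d j)
        ≈⟨ *-congˡ (*-congʳ (trans (∷-cong alt (λ _ → refl) (unit j)) (alternating-cycle alt j))) ⟩
      A zero j * (((- 1#) ^ toℕ j * Δ (scalar 1#)) * d j)
        ≈⟨ *-congˡ (trans (*-congʳ (*-comm _ _)) (*-assoc _ _ _)) ⟩
      A zero j * (Δ (scalar 1#) * ((- 1#) ^ toℕ j * d j))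
        ≈⟨ x∙yz≈y∙xz _ _ _ ⟩
      Δ (scalar 1#) * (A zero j * ((- 1#) ^ toℕ j * d j))
        ≈⟨ *-congˡ (x∙yz≈y∙xz _ _ _) ⟩
      Δ (scalar 1#) * ((- 1#) ^ toℕ j * (A zero j * d j)) ∎

  -- Determinants of transposes and products.

  det-cong : ∀ {n} {A B : Matrix Carrier n n} → A ≋ B → det rawRing A ≈ det rawRing B
  det-cong {zero}  A≋B = refl
  det-cong {suc n} A≋B = sum-cong λ j → *-congˡ {(- 1#) ^ toℕ j} (*-cong (A≋B zero j)
    (det-cong {n} λ i k → A≋B (suc i) (punchIn j k)))

  det-scalar : ∀ n x → det rawRing (scalar {n} x) ≈ x ^ n
  det-scalar zero    x = refl
  det-scalar (suc n) x = begin
    1# * (x * det rawRing (scalar {n} x)) + sum rest  ≈⟨ +-cong (trans (*-identityˡ _) (*-congˡ (det-scalar n x)))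
                                                    (sum-zero {f = rest} λ j → trans (*-congˡ (zeroˡ _)) (zeroʳ _)) ⟩
    x ^ suc n + 0#                             ≈⟨ +-identityʳ _ ⟩
    x ^ suc n                                  ∎
    where
    rest : Vector Carrier n
    rest j = (- 1#) ^ suc (toℕ j) * (0# * det rawRing (λ i k → scalar {suc n} x (suc i) (punchIn (suc j) k)))

  -- In the transpose, the first-row expansion runs down the first column of `A`. There all rows
  -- play the same part: each term pairs an entry of one row with a minor made of the remaining
  -- rows, so row properties follow by induction.
  detᵀ-isAlternating : ∀ {n} → IsAlternating {n} {n} (λ A → det rawRing (A ᵀ))
  detᵀ-isAlternating = record
    { Δ-cong = λ A≋B → det-cong λ i j → A≋B j i ; linear = detᵀ-linear ; alternating = detᵀ-alternating }
    where
    detᵀ-linear : ∀ {n} i x {A B C : Matrix Carrier n n} → AgreeOff i C A → AgreeOff i C B →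
      (∀ j → C i j ≈ A i j + x * B i j) → det rawRing (C ᵀ) ≈ det rawRing (A ᵀ) + x * det rawRing (B ᵀ)
    detᵀ-linear {suc n} i x {A} {B} {C} C≈A C≈B Ci≈ = begin
      sum (λ j → s j * (C j zero * d C j))
        ≈⟨ sum-cong term ⟩
      sum (λ j → s j * (A j zero * d A j) + x * (s j * (B j zero * d B j)))
        ≈⟨ ∑-distrib-+ (λ j → s j * (A j zero * d A j)) (λ j → x * (s j * (B j zero * d B j))) ⟩
      det rawRing (A ᵀ) + sum (λ j → x * (s j * (B j zero * d B j)))
        ≈⟨ +-congˡ (*-distribˡ-sum x (λ j → s j * (B j zero * d B j))) ⟨
      det rawRing (A ᵀ) + x * det rawRing (B ᵀ) ∎
      where
      s : Fin (suc n) → Carrier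
      s j = (- 1#) ^ toℕ j
      d : Matrix Carrier (suc n) (suc n) → Fin (suc n) → Carrier
      d A j = det rawRing ((λ k l → A (punchIn j k) (suc l)) ᵀ)
      term : ∀ j → s j * (C j zero * d C j) ≈ s j * (A j zero * d A j) + x * (s j * (B j zero * d B j))
      -- If j = i, the changed row contributes the entry and is missing from the minor. Otherwise
      -- the entry is unchanged and the minor is linear in that row by induction.
      term j with punchView j i
      ... | same = begin
        s i * (C i zero * d C i)
          ≈⟨ *-congˡ (*-congʳ (Ci≈ zero)) ⟩
        s i * ((A i zero + x * B i zero) * d C i)
          ≈⟨ *-congˡ (distribʳ _ _ _) ⟩
        s i * (A i zero * d C i + (x * B i zero) * d C i)
          ≈⟨ *-congˡ (+-cong (*-congˡ (det-cong λ k l → C≈A _ (punchInᵢ≢i i l) (suc k)))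
                             (trans (*-congˡ (det-cong λ k l → C≈B _ (punchInᵢ≢i i l) (suc k))) (*-assoc _ _ _))) ⟩
        s i * (A i zero * d A i + x * (B i zero * d B i))
          ≈⟨ trans (distribˡ _ _ _) (+-congˡ (x∙yz≈y∙xz _ _ _)) ⟩
        s i * (A i zero * d A i) + x * (s i * (B i zero * d B i)) ∎
      ... | punched k = begin
        s j * (C j zero * d C j)
          ≈⟨ *-congˡ (*-congˡ (detᵀ-linear k x
               (λ r r≢k l → C≈A _ (r≢k ∘ punchIn-injective j r k) (suc l))
               (λ r r≢k l → C≈B _ (r≢k ∘ punchIn-injective j r k) (suc l)) (λ l → Ci≈ (suc l)))) ⟩
        s j * (C j zero * (d A j + x * d B j))
          ≈⟨ *-congˡ (trans (distribˡ _ _ _) (+-cong (*-congʳ (C≈A j j≢i zero))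
               (trans (x∙yz≈y∙xz _ _ _) (*-congˡ (*-congʳ (C≈B j j≢i zero)))))) ⟩
        s j * (A j zero * d A j + x * (B j zero * d B j))
          ≈⟨ trans (distribˡ _ _ _) (+-congˡ (x∙yz≈y∙xz _ _ _)) ⟩
        s j * (A j zero * d A j) + x * (s j * (B j zero * d B j)) ∎
        where
        j≢i : j ≢ punchIn j k
        j≢i = punchInᵢ≢i j k ∘ ≡.sym

    detᵀ-alternating : ∀ {n} {i i′ : Fin n} A → Adjacent i i′ → (∀ j → A i j ≈ A i′ j) → det rawRing (A ᵀ) ≈ 0#
    -- Minors that retain both equal rows vanish by induction. The two remaining terms have equal
    -- entries and equal minors but opposite signs.
    detᵀ-alternating {suc n} {i} {i′} A adj A≈ = sum-adjacent adj cancel vanish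
      where
      d : Fin (suc n) → Carrier
      d j = det rawRing ((λ k l → A (punchIn j k) (suc l)) ᵀ)
      minors : d i′ ≈ d i
      minors = det-cong λ l k → same-rows l k (punchIn-adjacent adj k)
        where
        same-rows : ∀ l k → punchIn i k ≡ punchIn i′ k ⊎ (punchIn i k ≡ i′ × punchIn i′ k ≡ i) →
          A (punchIn i′ k) (suc l) ≈ A (punchIn i k) (suc l)
        same-rows l k (inj₁ eq) rewrite eq = refl
        same-rows l k (inj₂ (eq , eq′)) rewrite eq | eq′ = A≈ (suc l)
      cancel : (- 1#) ^ toℕ i * (A i zero * d i) + (- 1#) ^ toℕ i′ * (A i′ zero * d i′) ≈ 0#
      cancel = begin
        (- 1#) ^ toℕ i * (A i zero * d i) + (- 1#) ^ toℕ i′ * (A i′ zero * d i′)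
          ≈⟨ +-congˡ (*-cong (reflexive (≡.cong ((- 1#) ^_) (adjacent-toℕ adj))) (*-cong (sym (A≈ zero)) minors)) ⟩
        (- 1#) ^ toℕ i * (A i zero * d i) + (- 1# * (- 1#) ^ toℕ i) * (A i zero * d i)
          ≈⟨ +-congˡ (trans (*-assoc _ _ _) (-1*x≈-x _)) ⟩
        (- 1#) ^ toℕ i * (A i zero * d i) - (- 1#) ^ toℕ i * (A i zero * d i)
          ≈⟨ -‿inverseʳ _ ⟩
        0# ∎
      vanish : ∀ k → k ≢ i → k ≢ i′ → (- 1#) ^ toℕ k * (A k zero * d k) ≈ 0#
      vanish k k≢i k≢i′ with adjacent-punchIn adj k≢i k≢i′
      ... | j , j′ , adj′ , ≡.refl , ≡.refl = begin
        (- 1#) ^ toℕ k * (A k zero * d k)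
          ≈⟨ *-congˡ (*-congˡ (detᵀ-alternating (λ r l → A (punchIn k r) (suc l)) adj′ (λ l → A≈ (suc l)))) ⟩
        (- 1#) ^ toℕ k * (A k zero * 0#)  ≈⟨ *-congˡ (zeroʳ _) ⟩
        (- 1#) ^ toℕ k * 0#               ≈⟨ zeroʳ _ ⟩
        0#                                ∎

  1^n≈1 : ∀ n → 1# ^ n ≈ 1#
  1^n≈1 zero    = refl
  1^n≈1 (suc n) = trans (*-identityˡ _) (1^n≈1 n)

  det-one : ∀ {n} → det rawRing (scalar {n} 1#) ≈ 1#
  det-one {n} = trans (det-scalar n 1#) (1^n≈1 n)

  -- Uniqueness applied to A ↦ det Aᵀ, whose value at the identity is 1. The row properties proved
  -- for the transpose then pass to `det` itself.
  det-ᵀ : ∀ {n} (A : Matrix Carrier n n) → det rawRing (A ᵀ) ≈ det rawRing A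
  det-ᵀ {n} A = begin
    det rawRing (A ᵀ)                             ≈⟨ alternating-unique detᵀ-isAlternating A ⟩
    det rawRing (scalar {n} 1# ᵀ) * det rawRing A ≈⟨ *-congʳ (trans (det-cong {n} (λ i j → reflexive (scalar-sym 1# j i)))
                                                               (det-one {n})) ⟩
    1# * det rawRing A                            ≈⟨ *-identityˡ _ ⟩
    det rawRing A                                 ∎

  det-isAlternating : ∀ {n} → IsAlternating {n} {n} (det rawRing)
  det-isAlternating = record
    { Δ-cong      = det-cong
    ; linear      = λ i x {A} {B} {C} C≈A C≈B Ci≈ → trans (sym (det-ᵀ C)) (trans (linear i x C≈A C≈B Ci≈)
                      (+-cong (det-ᵀ A) (*-congˡ (det-ᵀ B))))
    ; alternating = λ A adj A≈ → trans (sym (det-ᵀ A)) (alternating A adj A≈)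
    }
    where open IsAlternating detᵀ-isAlternating

  -- For fixed B, the map A ↦ det (A B) is alternating in the rows of A and takes the value det B at
  -- the identity.
  det-⊗ : ∀ {n} (A B : Matrix Carrier n n) → det rawRing (A ⊗ B) ≈ det rawRing A * det rawRing B
  det-⊗ {n} A B = begin
    det rawRing (A ⊗ B)                         ≈⟨ alternating-unique ⊗B-isAlternating A ⟩
    det rawRing (scalar 1# ⊗ B) * det rawRing A ≈⟨ *-congʳ (det-cong λ i k → trans (sum-scalarˡ 1# i (λ j → B j k))
                                                              (*-identityˡ _)) ⟩
    det rawRing B * det rawRing A               ≈⟨ *-comm _ _ ⟩
    det rawRing A * det rawRing B               ∎
    where
    open IsAlternating (det-isAlternating {n})
    ⊗B-isAlternating : IsAlternating (λ A → det rawRing (A ⊗ B))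
    ⊗B-isAlternating = record
      { Δ-cong      = λ A≋A′ → det-cong λ i k → sum-cong λ j → *-congʳ (A≋A′ i j)
      ; linear      = λ i x {A} {A′} C≈A C≈A′ Ci≈ → linear i x
          (λ r r≢i k → sum-cong λ j → *-congʳ (C≈A r r≢i j))
          (λ r r≢i k → sum-cong λ j → *-congʳ (C≈A′ r r≢i j))
          (λ k → trans (sum-cong λ j → trans (*-congʳ (Ci≈ j)) (trans (distribʳ _ _ _) (+-congˡ (*-assoc _ _ _))))
                   (trans (∑-distrib-+ (λ j → A i j * B j k) (λ j → x * (A′ i j * B j k)))
                     (+-congˡ (sym (*-distribˡ-sum x λ j → A′ i j * B j k)))))
      ; alternating = λ A adj A≈ → alternating _ adj (λ k → sum-cong λ j → *-congʳ (A≈ j))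
      }

-- Block matrices, Schur complements and Sylvester's identity.

splitAt-punchIn : ∀ m {n} (j : Fin (suc m)) (k : Fin (m +ℕ n)) →
  splitAt (suc m) (punchIn (j ↑ˡ n) k) ≡ map⊎ (punchIn j) id (splitAt m k)
splitAt-punchIn m       zero    k       = ≡.refl
splitAt-punchIn (suc m) (suc j) zero    = ≡.refl
splitAt-punchIn (suc m) (suc j) (suc k) = ≡.trans (≡.cong (map⊎ suc id) (splitAt-punchIn m j k)) (commute (splitAt m k))
  where
  commute : ∀ {A : Set} (s : Fin m ⊎ A) → map⊎ suc id (map⊎ (punchIn j) id s) ≡ map⊎ (punchIn (suc j)) id (map⊎ suc id s)
  commute (inj₁ _) = ≡.refl
  commute (inj₂ _) = ≡.refl

module BlockMatrix {c ℓ} (R : CommutativeRing c ℓ) where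
  open CommutativeRing R hiding (zero)
  open MatrixRing R
  open import Algebra.Properties.Ring ring using (-‿distribˡ-*; -‿distribʳ-*; -1*x≈-x)
  open import Relation.Binary.Reasoning.Setoid setoid

  sum-↑ : ∀ m {n} (f : Vector Carrier (m +ℕ n)) →
    sum f ≈ sum (λ i → f (i ↑ˡ n)) + sum (λ j → f (m ↑ʳ j))
  sum-↑ zero    f = sym (+-identityˡ _)
  sum-↑ (suc m) f = trans (+-congˡ (sum-↑ m (f ∘ suc))) (sym (+-assoc _ _ _))

  sum-splitAt : ∀ m {n} (f : Vector Carrier m) (g : Vector Carrier n) →
    sum (λ i → [ f , g ]′ (splitAt m i)) ≈ sum f + sum g
  sum-splitAt m {n} f g = trans (sum-↑ m (λ i → [ f , g ]′ (splitAt m i))) (+-cong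
    (sum-cong λ i → reflexive (≡.cong [ f , g ]′ (splitAt-↑ˡ m i n)))
    (sum-cong λ j → reflexive (≡.cong [ f , g ]′ (splitAt-↑ʳ m n j))))

  sum-split : ∀ {m n} (f : Vector Carrier m) (g : Vector Carrier n) f′ g′ →
    sum (λ k → [ f , g ]′ (splitAt m k) * [ f′ , g′ ]′ (splitAt m k)) ≈
    sum (λ k → f k * f′ k) + sum (λ k → g k * g′ k)
  sum-split {m} f g f′ g′ = trans (sum-cong λ k → pointwise (splitAt m k)) (sum-splitAt m _ _)
    where
    pointwise : ∀ s → [ f , g ]′ s * [ f′ , g′ ]′ s ≈ [ (λ k → f k * f′ k) , (λ k → g k * g′ k) ]′ s
    pointwise (inj₁ _) = refl
    pointwise (inj₂ _) = refl

  block : ∀ {m n m′ n′} → Matrix Carrier m m′ → Matrix Carrier m n′ →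
          Matrix Carrier n m′ → Matrix Carrier n n′ → Matrix Carrier (m +ℕ n) (m′ +ℕ n′)
  block {m} {n} {m′} {n′} P Q S T i j =
    [ (λ i → [ P i , Q i ]′ (splitAt m′ j)) , (λ i → [ S i , T i ]′ (splitAt m′ j)) ]′ (splitAt m i)

  𝟘 : ∀ {m n} → Matrix Carrier m n
  𝟘 _ _ = 0#

  infixl 6 _⊞_
  _⊞_ : ∀ {m n} → Matrix Carrier m n → Matrix Carrier m n → Matrix Carrier m n
  (A ⊞ B) i j = A i j + B i j

  ⊟_ : ∀ {m n} → Matrix Carrier m n → Matrix Carrier m n
  (⊟ A) i j = - A i j

  module _ {m n m′ n′} {P P′ : Matrix Carrier m m′} {Q Q′ : Matrix Carrier m n′}
           {S S′ : Matrix Carrier n m′} {T T′ : Matrix Carrier n n′} where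
    block-cong : P ≋ P′ → Q ≋ Q′ → S ≋ S′ → T ≋ T′ → block P Q S T ≋ block P′ Q′ S′ T′
    block-cong P≋ Q≋ S≋ T≋ i j with splitAt m i | splitAt m′ j
    ... | inj₁ i | inj₁ j = P≋ i j
    ... | inj₁ i | inj₂ j = Q≋ i j
    ... | inj₂ i | inj₁ j = S≋ i j
    ... | inj₂ i | inj₂ j = T≋ i j

  module _ {m n m′ n′ m″ n″}
           (P : Matrix Carrier m m′) (Q : Matrix Carrier m n′) (S : Matrix Carrier n m′) (T : Matrix Carrier n n′)
           (P′ : Matrix Carrier m′ m″) (Q′ : Matrix Carrier m′ n″) (S′ : Matrix Carrier n′ m″) (T′ : Matrix Carrier n′ n″)
           where
    block-⊗ : block P Q S T ⊗ block P′ Q′ S′ T′ ≋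
              block (P ⊗ P′ ⊞ Q ⊗ S′) (P ⊗ Q′ ⊞ Q ⊗ T′) (S ⊗ P′ ⊞ T ⊗ S′) (S ⊗ Q′ ⊞ T ⊗ T′)
    block-⊗ i j with splitAt m i | splitAt m″ j
    ... | inj₁ i | inj₁ j = sum-split (P i) (Q i) (λ k → P′ k j) (λ k → S′ k j)
    ... | inj₁ i | inj₂ j = sum-split (P i) (Q i) (λ k → Q′ k j) (λ k → T′ k j)
    ... | inj₂ i | inj₁ j = sum-split (S i) (T i) (λ k → P′ k j) (λ k → S′ k j)
    ... | inj₂ i | inj₂ j = sum-split (S i) (T i) (λ k → Q′ k j) (λ k → T′ k j)

  block-ᵀ : ∀ {m n m′ n′} (P : Matrix Carrier m m′) (Q : Matrix Carrier m n′)
            (S : Matrix Carrier n m′) (T : Matrix Carrier n n′) →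
            block P Q S T ᵀ ≋ block (P ᵀ) (S ᵀ) (Q ᵀ) (T ᵀ)
  block-ᵀ {m} {n} {m′} P Q S T j i with splitAt m i | splitAt m′ j
  ... | inj₁ i | inj₁ j = refl
  ... | inj₁ i | inj₂ j = refl
  ... | inj₂ i | inj₁ j = refl
  ... | inj₂ i | inj₂ j = refl

  scalar-block : ∀ m {n} x → scalar {m +ℕ n} x ≋ block (scalar {m} x) 𝟘 𝟘 (scalar {n} x)
  scalar-block zero    x i       j       = refl
  scalar-block (suc m) x zero    zero    = refl
  scalar-block (suc m) x zero    (suc j) with splitAt m j
  ... | inj₁ _ = refl
  ... | inj₂ _ = refl
  scalar-block (suc m) x (suc i) zero    with splitAt m i
  ... | inj₁ _ = refl
  ... | inj₂ _ = refl
  scalar-block (suc m) x (suc i) (suc j) with splitAt m i | splitAt m j | scalar-block m x i j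
  ... | inj₁ _ | inj₁ _ | eq = eq
  ... | inj₁ _ | inj₂ _ | eq = eq
  ... | inj₂ _ | inj₁ _ | eq = eq
  ... | inj₂ _ | inj₂ _ | eq = eq

  -- Expand along the top row: the columns of the zero block contribute nothing, and deleting a
  -- column of `P` leaves a matrix of the same block shape.
  det-block-lower : ∀ {m n} (P : Matrix Carrier m m) (S : Matrix Carrier n m) (T : Matrix Carrier n n) →
    det rawRing (block P 𝟘 S T) ≈ det rawRing P * det rawRing T
  det-block-lower {zero}  {n} P S T = sym (*-identityˡ _)
  det-block-lower {suc m} {n} P S T = begin
    sum f
      ≈⟨ sum-↑ (suc m) f ⟩
    sum (λ j → f (j ↑ˡ n)) + sum (λ j → f (suc m ↑ʳ j))
      ≈⟨ +-cong (sum-cong left) (sum-zero {f = λ j → f (suc m ↑ʳ j)} right) ⟩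
    sum (λ j → ((- 1#) ^ toℕ j * (P zero j * d j)) * det rawRing T) + 0#
      ≈⟨ +-identityʳ _ ⟩
    sum (λ j → ((- 1#) ^ toℕ j * (P zero j * d j)) * det rawRing T)
      ≈⟨ *-distribʳ-sum (det rawRing T) (λ j → (- 1#) ^ toℕ j * (P zero j * d j)) ⟨
    det rawRing P * det rawRing T ∎
    where
    minor : Fin (suc m +ℕ n) → Matrix Carrier (m +ℕ n) (m +ℕ n)
    minor j i k = block P 𝟘 S T (suc i) (punchIn j k)
    f : Vector Carrier (suc m +ℕ n)
    f j = (- 1#) ^ toℕ j * (block P 𝟘 S T zero j * det rawRing (minor j))
    d : Fin (suc m) → Carrier
    d j = det rawRing (λ i k → P (suc i) (punchIn j k))
    minor-block : ∀ j → minor (j ↑ˡ n) ≋ block (λ i k → P (suc i) (punchIn j k)) 𝟘 (λ i k → S i (punchIn j k)) T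
    minor-block j i k rewrite splitAt-punchIn m {n} j k with splitAt m i | splitAt m k
    ... | inj₁ i | inj₁ k = refl
    ... | inj₁ i | inj₂ k = refl
    ... | inj₂ i | inj₁ k = refl
    ... | inj₂ i | inj₂ k = refl
    left : ∀ j → f (j ↑ˡ n) ≈ ((- 1#) ^ toℕ j * (P zero j * d j)) * det rawRing T
    left j = begin
      f (j ↑ˡ n)
        ≈⟨ *-cong (reflexive (≡.cong ((- 1#) ^_) (toℕ-↑ˡ j n)))
             (*-cong (reflexive (≡.cong [ P zero , 𝟘 {suc m} zero ]′ (splitAt-↑ˡ (suc m) j n)))
               (trans (det-cong (minor-block j)) (det-block-lower (λ i k → P (suc i) (punchIn j k)) (λ i k → S i (punchIn j k)) T))) ⟩
      (- 1#) ^ toℕ j * (P zero j * (d j * det rawRing T))  ≈⟨ *-congˡ (*-assoc _ _ _) ⟨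
      (- 1#) ^ toℕ j * ((P zero j * d j) * det rawRing T)  ≈⟨ *-assoc _ _ _ ⟨
      ((- 1#) ^ toℕ j * (P zero j * d j)) * det rawRing T  ∎
    right : ∀ j → f (suc m ↑ʳ j) ≈ 0#
    right j = trans (*-congˡ (trans (*-congʳ (reflexive
      (≡.cong [ P zero , 𝟘 {suc m} zero ]′ (splitAt-↑ʳ (suc m) n j)))) (zeroˡ _))) (zeroʳ _)

  det-block-upper : ∀ {m n} (P : Matrix Carrier m m) (Q : Matrix Carrier m n) (T : Matrix Carrier n n) →
    det rawRing (block P Q 𝟘 T) ≈ det rawRing P * det rawRing T
  det-block-upper P Q T = begin
    det rawRing (block P Q 𝟘 T)                  ≈⟨ det-ᵀ (block P Q 𝟘 T) ⟨
    det rawRing (block P Q 𝟘 T ᵀ)                ≈⟨ det-cong (block-ᵀ P Q 𝟘 T) ⟩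
    det rawRing (block (P ᵀ) 𝟘 (Q ᵀ) (T ᵀ))      ≈⟨ det-block-lower (P ᵀ) (Q ᵀ) (T ᵀ) ⟩
    det rawRing (P ᵀ) * det rawRing (T ᵀ)        ≈⟨ *-cong (det-ᵀ P) (det-ᵀ T) ⟩
    det rawRing P * det rawRing T                ∎

  ⊗-scalarˡ : ∀ {m n} x (A : Matrix Carrier m n) i j → (scalar x ⊗ A) i j ≈ x * A i j
  ⊗-scalarˡ x A i j = sum-scalarˡ x i (λ k → A k j)

  ⊗-scalarʳ : ∀ {m n} x (A : Matrix Carrier m n) i j → (A ⊗ scalar x) i j ≈ A i j * x
  ⊗-scalarʳ x A i j = sum-scalarʳ x j (A i)

  scalar-* : ∀ {n} x y (i j : Fin n) → x * scalar y i j ≈ scalar (x * y) i j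
  scalar-* x y i j with i ≟ j
  ... | yes _ = refl
  ... | no  _ = zeroʳ x

  scalar-cong : ∀ {n x y} → x ≈ y → scalar {n} x ≋ scalar y
  scalar-cong x≈y i j with i ≟ j
  ... | yes _ = x≈y
  ... | no  _ = refl

  ⊗-zeroʳ : ∀ {m n o} (A : Matrix Carrier m n) (i : Fin m) (j : Fin o) → (A ⊗ 𝟘) i j ≈ 0#
  ⊗-zeroʳ A i j = sum-zero λ k → zeroʳ (A i k)

  ⊗-zeroˡ : ∀ {m n o} (A : Matrix Carrier n o) (i : Fin m) (j : Fin o) → (𝟘 ⊗ A) i j ≈ 0#
  ⊗-zeroˡ A i j = sum-zero λ k → zeroˡ (A k j)

  sum-neg : ∀ {n} (f : Vector Carrier n) → sum (λ i → - f i) ≈ - sum f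
  sum-neg f = begin
    sum (λ i → - f i)       ≈⟨ sum-cong (λ i → sym (-1*x≈-x (f i))) ⟩
    sum (λ i → - 1# * f i)  ≈⟨ *-distribˡ-sum (- 1#) f ⟨
    - 1# * sum f            ≈⟨ -1*x≈-x (sum f) ⟩
    - sum f                 ∎

  ⊗-negʳ : ∀ {m n o} (A : Matrix Carrier m n) (B : Matrix Carrier n o) → A ⊗ (⊟ B) ≋ ⊟ (A ⊗ B)
  ⊗-negʳ A B i j = trans (sum-cong λ k → sym (-‿distribʳ-* (A i k) (B k j))) (sum-neg λ k → A i k * B k j)

  ⊗-negˡ : ∀ {m n o} (A : Matrix Carrier m n) (B : Matrix Carrier n o) → (⊟ A) ⊗ B ≋ ⊟ (A ⊗ B)
  ⊗-negˡ A B i j = trans (sum-cong λ k → sym (-‿distribˡ-* (A i k) (B k j))) (sum-neg λ k → A i k * B k j)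

  module _ {m n} (x y : Carrier) (A : Matrix Carrier m n) (C : Matrix Carrier n m) where
    -- Right multiplication by [y 0; -C 1] clears the lower left block, because the scalar y
    -- commutes with `C`. The factor y ^ m is the determinant of that multiplier and takes the place
    -- of an inverse of y.
    det-schur₁ : y ^ m * det rawRing (block (scalar x) A C (scalar y)) ≈
                 y ^ n * det rawRing (scalar (x * y) ⊞ ⊟ (A ⊗ C))
    det-schur₁ = begin
      y ^ m * det rawRing Z                  ≈⟨ *-comm _ _ ⟩
      det rawRing Z * y ^ m                  ≈⟨ *-congˡ det-E ⟨
      det rawRing Z * det rawRing E          ≈⟨ det-⊗ Z E ⟨
      det rawRing (Z ⊗ E)                    ≈⟨ det-cong (λ i j → trans
         (block-⊗ (scalar x) A C (scalar y) (scalar y) 𝟘 (⊟ C) (scalar 1#) i j)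
        (block-cong
        (λ i j → +-cong (trans (⊗-scalarˡ x (scalar y) i j) (scalar-* x y i j)) (⊗-negʳ A C i j))
        (λ i j → trans (+-cong (⊗-zeroʳ (scalar x) i j) (trans (⊗-scalarʳ 1# A i j) (*-identityʳ _))) (+-identityˡ _))
        (λ i j → trans (+-cong (⊗-scalarʳ y C i j)
          (trans (⊗-scalarˡ y (⊟ C) i j) (trans (sym (-‿distribʳ-* _ _)) (-‿cong (*-comm _ _))))) (-‿inverseʳ _))
        (λ i j → trans (+-cong (⊗-zeroʳ C i j) (trans (⊗-scalarʳ 1# (scalar y) i j) (*-identityʳ _))) (+-identityˡ _)) i j)) ⟩
      det rawRing (block (scalar (x * y) ⊞ ⊟ (A ⊗ C)) A 𝟘 (scalar y)) ≈⟨ det-block-upper _ A (scalar y) ⟩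
      det rawRing (scalar (x * y) ⊞ ⊟ (A ⊗ C)) * det rawRing (scalar {n} y) ≈⟨ *-congˡ (det-scalar n y) ⟩
      det rawRing (scalar (x * y) ⊞ ⊟ (A ⊗ C)) * y ^ n ≈⟨ *-comm _ _ ⟩
      y ^ n * det rawRing (scalar (x * y) ⊞ ⊟ (A ⊗ C)) ∎
      where
      Z E : Matrix Carrier (m +ℕ n) (m +ℕ n)
      Z = block (scalar x) A C (scalar y)
      E = block (scalar y) 𝟘 (⊟ C) (scalar 1#)
      det-E : det rawRing E ≈ y ^ m
      det-E = trans (det-block-lower (scalar y) (⊟ C) (scalar 1#))
        (trans (*-cong (det-scalar m y) (det-one {n})) (*-identityʳ _))

    -- The mirror image: left multiplication by [1 0; -C x], of determinant x ^ n, clears the same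
    -- block but leaves the complement in the other corner, with the product in the other order.
    det-schur₂ : x ^ n * det rawRing (block (scalar x) A C (scalar y)) ≈
                 x ^ m * det rawRing (scalar (x * y) ⊞ ⊟ (C ⊗ A))
    det-schur₂ = begin
      x ^ n * det rawRing Z                  ≈⟨ *-congʳ det-E ⟨
      det rawRing E * det rawRing Z          ≈⟨ det-⊗ E Z ⟨
      det rawRing (E ⊗ Z)                    ≈⟨ det-cong (λ i j → trans
         (block-⊗ (scalar 1#) 𝟘 (⊟ C) (scalar x) (scalar x) A C (scalar y) i j)
        (block-cong
        (λ i j → trans (+-cong (trans (⊗-scalarˡ 1# (scalar x) i j) (*-identityˡ _)) (⊗-zeroˡ C i j)) (+-identityʳ _))
        (λ i j → trans (+-cong (trans (⊗-scalarˡ 1# A i j) (*-identityˡ _)) (⊗-zeroˡ (scalar y) i j)) (+-identityʳ _))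
        (λ i j → trans (+-cong
          (trans (⊗-scalarʳ x (⊟ C) i j) (trans (sym (-‿distribˡ-* _ _)) (-‿cong (*-comm _ _)))) (⊗-scalarˡ x C i j)) (-‿inverseˡ _))
        (λ i j → trans (+-cong (⊗-negˡ C A i j) (trans (⊗-scalarˡ x (scalar y) i j) (scalar-* x y i j))) (+-comm _ _)) i j)) ⟩
      det rawRing (block (scalar x) A 𝟘 (scalar (x * y) ⊞ ⊟ (C ⊗ A))) ≈⟨ det-block-upper (scalar x) A _ ⟩
      det rawRing (scalar {m} x) * det rawRing (scalar (x * y) ⊞ ⊟ (C ⊗ A)) ≈⟨ *-congʳ (det-scalar m x) ⟩
      x ^ m * det rawRing (scalar (x * y) ⊞ ⊟ (C ⊗ A)) ∎
      where
      Z E : Matrix Carrier (m +ℕ n) (m +ℕ n)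
      Z = block (scalar x) A C (scalar y)
      E = block (scalar 1#) 𝟘 (⊟ C) (scalar x)
      det-E : det rawRing E ≈ x ^ n
      det-E = trans (det-block-lower (scalar 1#) (⊟ C) (scalar x))
        (trans (*-cong (det-one {m}) (det-scalar n x)) (*-identityˡ _))

  -- Both sides evaluate x ^ n times the determinant of [x A; C 1], one through each Schur
  -- complement.
  det-sylvester : ∀ {m n} x (A : Matrix Carrier m n) (C : Matrix Carrier n m) →
    x ^ n * det rawRing (scalar x ⊞ ⊟ (A ⊗ C)) ≈ x ^ m * det rawRing (scalar x ⊞ ⊟ (C ⊗ A))
  det-sylvester {m} {n} x A C = begin
    x ^ n * det rawRing (scalar x ⊞ ⊟ (A ⊗ C))        ≈⟨ *-congˡ (x*1 (⊟ (A ⊗ C))) ⟨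
    x ^ n * det rawRing (scalar (x * 1#) ⊞ ⊟ (A ⊗ C)) ≈⟨ *-congˡ (unit-power n) ⟨
    x ^ n * (1# ^ n * det rawRing (scalar (x * 1#) ⊞ ⊟ (A ⊗ C))) ≈⟨ *-congˡ (det-schur₁ x 1# A C) ⟨
    x ^ n * (1# ^ m * det rawRing (block (scalar x) A C (scalar 1#))) ≈⟨ *-congˡ (unit-power m) ⟩
    x ^ n * det rawRing (block (scalar x) A C (scalar 1#)) ≈⟨ det-schur₂ x 1# A C ⟩
    x ^ m * det rawRing (scalar (x * 1#) ⊞ ⊟ (C ⊗ A)) ≈⟨ *-congˡ (x*1 (⊟ (C ⊗ A))) ⟩
    x ^ m * det rawRing (scalar x ⊞ ⊟ (C ⊗ A))        ∎
    where
    unit-power : ∀ k {z} → 1# ^ k * z ≈ z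
    unit-power k = trans (*-congʳ (1^n≈1 k)) (*-identityˡ _)
    x*1 : ∀ {k} (M : Matrix Carrier k k) → det rawRing (scalar (x * 1#) ⊞ M) ≈ det rawRing (scalar x ⊞ M)
    x*1 {k} M = det-cong {k} λ i j → +-congʳ {M i j} (scalar-cong (*-identityʳ x) i j)

-- The commutative ring of polynomials.

module PolynomialRing {c ℓ} (R : CommutativeRing c ℓ) where
  open CommutativeRing R hiding (zero)
  open Polynomial rawRing renaming (const to constᴾ)
  open import Algebra.Properties.Ring ring using (-0#≈0#)
  open import Algebra.Properties.CommutativeSemigroup +-commutativeSemigroup
    using () renaming (interchange to +-interchange; x∙yz≈y∙xz to x+[y+z]≈y+[x+z])
  open import Relation.Binary.Reasoning.Setoid setoid

  infix 4 _≈ᴾ_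
  _≈ᴾ_ : Poly → Poly → Set ℓ
  p ≈ᴾ q = ∀ i → coeff p i ≈ coeff q i

  scale : Carrier → Poly → Poly
  scale x = map (x *_)

  shift : Poly → Poly
  shift p = 0# ∷ᴸ p

  coeff-+ : ∀ p q i → coeff (p +ᴾ q) i ≈ coeff p i + coeff q i
  coeff-+ []      q       i       = sym (+-identityˡ _)
  coeff-+ (x ∷ᴸ p) []      i       = sym (+-identityʳ _)
  coeff-+ (x ∷ᴸ p) (y ∷ᴸ q) zero    = refl
  coeff-+ (x ∷ᴸ p) (y ∷ᴸ q) (suc i) = coeff-+ p q i

  coeff-scale : ∀ x p i → coeff (scale x p) i ≈ x * coeff p i
  coeff-scale x []      i       = sym (zeroʳ x)
  coeff-scale x (y ∷ᴸ p) zero    = refl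
  coeff-scale x (y ∷ᴸ p) (suc i) = coeff-scale x p i

  coeff-neg : ∀ p i → coeff (map (-_) p) i ≈ - coeff p i
  coeff-neg []      i       = sym -0#≈0#
  coeff-neg (y ∷ᴸ p) zero    = refl
  coeff-neg (y ∷ᴸ p) (suc i) = coeff-neg p i

  shift-cong : ∀ {p q} → p ≈ᴾ q → shift p ≈ᴾ shift q
  shift-cong p≈q zero    = refl
  shift-cong p≈q (suc i) = p≈q i

  coeff-shift-0 : ∀ {p} → p ≈ᴾ [] → shift p ≈ᴾ []
  coeff-shift-0 p≈0 zero    = refl
  coeff-shift-0 p≈0 (suc i) = p≈0 i

  coeff-shift-+ : ∀ p q i → coeff (shift (p +ᴾ q)) i ≈ coeff (shift p) i + coeff (shift q) i
  coeff-shift-+ p q zero    = sym (+-identityˡ 0#)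
  coeff-shift-+ p q (suc i) = coeff-+ p q i

  coeff-shift-scale : ∀ x p i → coeff (shift (scale x p)) i ≈ x * coeff (shift p) i
  coeff-shift-scale x p zero    = sym (zeroʳ x)
  coeff-shift-scale x p (suc i) = coeff-scale x p i

  coeff-∷-* : ∀ x p q i → coeff ((x ∷ᴸ p) *ᴾ q) i ≈ x * coeff q i + coeff (shift (p *ᴾ q)) i
  coeff-∷-* x p q i = trans (coeff-+ (scale x q) (shift (p *ᴾ q)) i) (+-congʳ (coeff-scale x q i))

  +-congᴾ : ∀ {p p′ q q′} → p ≈ᴾ p′ → q ≈ᴾ q′ → p +ᴾ q ≈ᴾ p′ +ᴾ q′
  +-congᴾ {p} {p′} {q} {q′} p≈ q≈ i = trans (coeff-+ p q i) (trans (+-cong (p≈ i) (q≈ i)) (sym (coeff-+ p′ q′ i)))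

  -- A list of zeros equals [] without being []. Congruence in the first factor meets this case
  -- whenever equal polynomials are given by lists of different lengths.
  *-annihilatesˡ : ∀ p q → p ≈ᴾ [] → p *ᴾ q ≈ᴾ []
  *-annihilatesˡ []      q p≈0 i = refl
  *-annihilatesˡ (x ∷ᴸ p) q p≈0 i = begin
    coeff ((x ∷ᴸ p) *ᴾ q) i                   ≈⟨ coeff-∷-* x p q i ⟩
    x * coeff q i + coeff (shift (p *ᴾ q)) i ≈⟨ +-cong (trans (*-congʳ (p≈0 zero)) (zeroˡ _))
                                                  (coeff-shift-0 (*-annihilatesˡ p q λ i → p≈0 (suc i)) i) ⟩
    0# + 0#                                  ≈⟨ +-identityˡ 0# ⟩
    0#                                       ∎

  *-congʳᴾ : ∀ p p′ q → p ≈ᴾ p′ → p *ᴾ q ≈ᴾ p′ *ᴾ q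
  *-congʳᴾ []      p′       q p≈ i = sym (*-annihilatesˡ p′ q (λ i → sym (p≈ i)) i)
  *-congʳᴾ (x ∷ᴸ p) []       q p≈ i = *-annihilatesˡ (x ∷ᴸ p) q p≈ i
  *-congʳᴾ (x ∷ᴸ p) (y ∷ᴸ p′) q p≈ i = trans (coeff-∷-* x p q i) (trans
    (+-cong (*-congʳ (p≈ zero)) (shift-cong (*-congʳᴾ p p′ q λ i → p≈ (suc i)) i)) (sym (coeff-∷-* y p′ q i)))

  *-distribʳᴾ : ∀ p q r → (p +ᴾ q) *ᴾ r ≈ᴾ (p *ᴾ r) +ᴾ (q *ᴾ r)
  *-distribʳᴾ []      q       r i = refl
  *-distribʳᴾ (x ∷ᴸ p) []      r i = sym (trans (coeff-+ ((x ∷ᴸ p) *ᴾ r) [] i) (+-identityʳ _))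
  *-distribʳᴾ (x ∷ᴸ p) (y ∷ᴸ q) r i = begin
    coeff (((x + y) ∷ᴸ (p +ᴾ q)) *ᴾ r) i
      ≈⟨ coeff-∷-* (x + y) (p +ᴾ q) r i ⟩
    (x + y) * coeff r i + coeff (shift ((p +ᴾ q) *ᴾ r)) i
      ≈⟨ +-cong (distribʳ _ x y) (trans (shift-cong (*-distribʳᴾ p q r) i) (coeff-shift-+ (p *ᴾ r) (q *ᴾ r) i)) ⟩
    (x * coeff r i + y * coeff r i) + (coeff (shift (p *ᴾ r)) i + coeff (shift (q *ᴾ r)) i)
      ≈⟨ +-interchange _ _ _ _ ⟩
    (x * coeff r i + coeff (shift (p *ᴾ r)) i) + (y * coeff r i + coeff (shift (q *ᴾ r)) i)
      ≈⟨ +-cong (coeff-∷-* x p r i) (coeff-∷-* y q r i) ⟨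
    coeff ((x ∷ᴸ p) *ᴾ r) i + coeff ((y ∷ᴸ q) *ᴾ r) i
      ≈⟨ coeff-+ ((x ∷ᴸ p) *ᴾ r) ((y ∷ᴸ q) *ᴾ r) i ⟨
    coeff (((x ∷ᴸ p) *ᴾ r) +ᴾ ((y ∷ᴸ q) *ᴾ r)) i ∎

  scale-* : ∀ x p q → scale x p *ᴾ q ≈ᴾ scale x (p *ᴾ q)
  scale-* x []      q i = refl
  scale-* x (y ∷ᴸ p) q i = begin
    coeff (((x * y) ∷ᴸ scale x p) *ᴾ q) i
      ≈⟨ coeff-∷-* (x * y) (scale x p) q i ⟩
    (x * y) * coeff q i + coeff (shift (scale x p *ᴾ q)) i
      ≈⟨ +-cong (*-assoc x y _) (trans (shift-cong (scale-* x p q) i) (coeff-shift-scale x (p *ᴾ q) i)) ⟩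
    x * (y * coeff q i) + x * coeff (shift (p *ᴾ q)) i
      ≈⟨ distribˡ x _ _ ⟨
    x * (y * coeff q i + coeff (shift (p *ᴾ q)) i)
      ≈⟨ *-congˡ (coeff-∷-* y p q i) ⟨
    x * coeff ((y ∷ᴸ p) *ᴾ q) i
      ≈⟨ coeff-scale x ((y ∷ᴸ p) *ᴾ q) i ⟨
    coeff (scale x ((y ∷ᴸ p) *ᴾ q)) i ∎

  shift-* : ∀ p q → shift p *ᴾ q ≈ᴾ shift (p *ᴾ q)
  shift-* p q i = trans (coeff-∷-* 0# p q i) (trans (+-congʳ (zeroˡ _)) (+-identityˡ _))

  *-assocᴾ : ∀ p q r → (p *ᴾ q) *ᴾ r ≈ᴾ p *ᴾ (q *ᴾ r)
  *-assocᴾ []      q r i = refl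
  *-assocᴾ (x ∷ᴸ p) q r i = begin
    coeff ((scale x q +ᴾ shift (p *ᴾ q)) *ᴾ r) i
      ≈⟨ *-distribʳᴾ (scale x q) (shift (p *ᴾ q)) r i ⟩
    coeff ((scale x q *ᴾ r) +ᴾ (shift (p *ᴾ q) *ᴾ r)) i
      ≈⟨ +-congᴾ {scale x q *ᴾ r} {scale x (q *ᴾ r)} {shift (p *ᴾ q) *ᴾ r} {shift (p *ᴾ (q *ᴾ r))} (scale-* x q r)
           (λ i → trans (shift-* (p *ᴾ q) r i) (shift-cong (*-assocᴾ p q r) i)) i ⟩
    coeff (scale x (q *ᴾ r) +ᴾ shift (p *ᴾ (q *ᴾ r))) i ∎

  *-zeroʳᴾ : ∀ p → p *ᴾ [] ≈ᴾ []
  *-zeroʳᴾ []      i = refl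
  *-zeroʳᴾ (x ∷ᴸ p) i = coeff-shift-0 (*-zeroʳᴾ p) i

  -- Multiplication recurses on its first factor. This is the corresponding recursion on the second,
  -- and comparing it with `coeff-∷-*` yields commutativity.
  coeff-*-∷ : ∀ p y q i → coeff (p *ᴾ (y ∷ᴸ q)) i ≈ y * coeff p i + coeff (shift (p *ᴾ q)) i
  coeff-*-∷ []      y q zero    = sym (trans (+-identityʳ _) (zeroʳ y))
  coeff-*-∷ []      y q (suc i) = sym (trans (+-identityʳ _) (zeroʳ y))
  coeff-*-∷ (x ∷ᴸ p) y q zero    = +-congʳ (*-comm x y)
  coeff-*-∷ (x ∷ᴸ p) y q (suc i) = begin
    coeff (scale x q +ᴾ (p *ᴾ (y ∷ᴸ q))) i
      ≈⟨ coeff-+ (scale x q) (p *ᴾ (y ∷ᴸ q)) i ⟩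
    coeff (scale x q) i + coeff (p *ᴾ (y ∷ᴸ q)) i
      ≈⟨ +-congˡ (coeff-*-∷ p y q i) ⟩
    coeff (scale x q) i + (y * coeff p i + coeff (shift (p *ᴾ q)) i)
      ≈⟨ x+[y+z]≈y+[x+z] _ _ _ ⟩
    y * coeff p i + (coeff (scale x q) i + coeff (shift (p *ᴾ q)) i)
      ≈⟨ +-congˡ (coeff-+ (scale x q) (shift (p *ᴾ q)) i) ⟨
    y * coeff p i + coeff (scale x q +ᴾ shift (p *ᴾ q)) i ∎

  *-commᴾ : ∀ p q → p *ᴾ q ≈ᴾ q *ᴾ p
  *-commᴾ []      q i = sym (*-zeroʳᴾ q i)
  *-commᴾ (x ∷ᴸ p) q i = begin
    coeff ((x ∷ᴸ p) *ᴾ q) i                   ≈⟨ coeff-∷-* x p q i ⟩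
    x * coeff q i + coeff (shift (p *ᴾ q)) i ≈⟨ +-congˡ (shift-cong (*-commᴾ p q) i) ⟩
    x * coeff q i + coeff (shift (q *ᴾ p)) i ≈⟨ coeff-*-∷ q x p i ⟨
    coeff (q *ᴾ (x ∷ᴸ p)) i                   ∎

  *-congᴾ : ∀ {p p′ q q′} → p ≈ᴾ p′ → q ≈ᴾ q′ → p *ᴾ q ≈ᴾ p′ *ᴾ q′
  *-congᴾ {p} {p′} {q} {q′} p≈ q≈ i = begin
    coeff (p *ᴾ q) i    ≈⟨ *-congʳᴾ p p′ q p≈ i ⟩
    coeff (p′ *ᴾ q) i   ≈⟨ *-commᴾ p′ q i ⟩
    coeff (q *ᴾ p′) i   ≈⟨ *-congʳᴾ q q′ p′ q≈ i ⟩
    coeff (q′ *ᴾ p′) i  ≈⟨ *-commᴾ q′ p′ i ⟩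
    coeff (p′ *ᴾ q′) i  ∎

  coeff-const-* : ∀ x q i → coeff (constᴾ x *ᴾ q) i ≈ x * coeff q i
  coeff-const-* x q i = trans (coeff-∷-* x [] q i) (trans (+-congˡ (coeff-shift-0 {[]} (λ _ → refl) i)) (+-identityʳ _))

  *-identityˡᴾ : ∀ p → constᴾ 1# *ᴾ p ≈ᴾ p
  *-identityˡᴾ p i = trans (coeff-const-* 1# p i) (*-identityˡ _)

  polynomialRing : CommutativeRing c ℓ
  polynomialRing = record
    { Carrier = Poly
    ; _≈_     = _≈ᴾ_
    ; _+_     = _+ᴾ_
    ; _*_     = _*ᴾ_
    ; -_      = map (-_)
    ; 0#      = []
    ; 1#      = constᴾ 1#
    ; isCommutativeRing = record
      { isRing = record
        { +-isAbelianGroup = record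
          { isGroup = record
            { isMonoid = record
              { isSemigroup = record
                { isMagma = record
                  { isEquivalence = record
                    { refl = λ i → refl ; sym = λ p≈q i → sym (p≈q i) ; trans = λ p≈q q≈r i → trans (p≈q i) (q≈r i) }
                  ; ∙-cong = λ {p} {p′} {q} {q′} → +-congᴾ {p} {p′} {q} {q′}
                  }
                ; assoc = λ p q r i → begin
                    coeff ((p +ᴾ q) +ᴾ r) i              ≈⟨ trans (coeff-+ (p +ᴾ q) r i) (+-congʳ (coeff-+ p q i)) ⟩
                    (coeff p i + coeff q i) + coeff r i  ≈⟨ +-assoc _ _ _ ⟩
                    coeff p i + (coeff q i + coeff r i)  ≈⟨ trans (coeff-+ p (q +ᴾ r) i) (+-congˡ (coeff-+ q r i)) ⟨
                    coeff (p +ᴾ (q +ᴾ r)) i              ∎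
                }
              ; identity = (λ p i → refl) , (λ p i → trans (coeff-+ p [] i) (+-identityʳ _))
              }
            ; inverse = (λ p i → trans (coeff-+ (map (-_) p) p i) (trans (+-congʳ (coeff-neg p i)) (-‿inverseˡ _)))
                      , (λ p i → trans (coeff-+ p (map (-_) p) i) (trans (+-congˡ (coeff-neg p i)) (-‿inverseʳ _)))
            ; ⁻¹-cong = λ {p} {q} p≈q i → trans (coeff-neg p i) (trans (-‿cong (p≈q i)) (sym (coeff-neg q i)))
            }
          ; comm = λ p q i → trans (coeff-+ p q i) (trans (+-comm _ _) (sym (coeff-+ q p i)))
          }
        ; *-cong = λ {p} {p′} {q} {q′} → *-congᴾ {p} {p′} {q} {q′}
        ; *-assoc = *-assocᴾ
        ; *-identity = *-identityˡᴾ , (λ p i → trans (*-commᴾ p (constᴾ 1#) i) (*-identityˡᴾ p i))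
        ; distrib = (λ p q r i → begin
                      coeff (p *ᴾ (q +ᴾ r)) i          ≈⟨ *-commᴾ p (q +ᴾ r) i ⟩
                      coeff ((q +ᴾ r) *ᴾ p) i          ≈⟨ *-distribʳᴾ q r p i ⟩
                      coeff ((q *ᴾ p) +ᴾ (r *ᴾ p)) i   ≈⟨ +-congᴾ {q *ᴾ p} {p *ᴾ q} {r *ᴾ p} {p *ᴾ r}
                                                            (*-commᴾ q p) (*-commᴾ r p) i ⟩
                      coeff ((p *ᴾ q) +ᴾ (p *ᴾ r)) i   ∎)
                  , (λ r p q → *-distribʳᴾ p q r)
        }
      ; *-comm = *-commᴾ
      }
    }

  -- Multiplying by X only shifts the coefficients, so it is injective over every commutative
  -- coefficient ring, whether or not that ring has zero divisors.
  X-cancelˡ : ∀ p q → X *ᴾ p ≈ᴾ X *ᴾ q → p ≈ᴾ q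
  X-cancelˡ p q Xp≈Xq i = trans (sym (coeff-X p)) (trans (Xp≈Xq (suc i)) (coeff-X q))
    where
    coeff-X : ∀ r → coeff (X *ᴾ r) (suc i) ≈ coeff r i
    coeff-X r = trans (shift-* (constᴾ 1#) r (suc i)) (*-identityˡᴾ r i)

-- The row of [0 B; Bᵀ 0] that a row of F_k ⊕ 0 copies; nothing in the padding.
class : ∀ p q n k .{{_ : NonZero k}} → Fin (sizeF p q k (n / k) +ℕ padding p q n k) → Maybe (Fin (p +ℕ q))
class p q n k i = [ just ∘ join p q ∘ position p q k (n / k) , const nothing ]′ (splitAt (sizeF p q k (n / k)) i)

-- Matrices with repeated rows and columns, and F_k ⊕ 0 as one of them.

module BlowUp {c ℓ} (R : CommutativeRing c ℓ) where
  open CommutativeRing R hiding (zero)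
  open MatrixRing R
  open BlockMatrix R
  open import Algebra.Properties.Ring ring using (-‿distribˡ-*; -‿distribʳ-*; -0#≈0#; -‿involutive)
  open import Algebra.Properties.Semiring.Mult semiring using (×-congʳ; ×1-homo-*) renaming (_×_ to _·_)
  open import Algebra.Properties.CommutativeSemigroup *-commutativeSemigroup using (interchange; x∙yz≈y∙xz)
  open import Algebra.Properties.CommutativeSemigroup +-commutativeSemigroup using () renaming (x∙yz≈y∙xz to x+[y+z]≈y+[x+z])
  open import Relation.Binary.Reasoning.Setoid setoid

  module _ {N r} (f : Fin N → Maybe (Fin r)) where

    entry : Matrix Carrier r r → Maybe (Fin r) → Maybe (Fin r) → Carrier
    entry G (just a) (just b) = G a b
    entry G (just _) nothing  = 0#
    entry G nothing  _        = 0#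

    blowUp : Matrix Carrier r r → Matrix Carrier N N
    blowUp G i j = entry G (f i) (f j)

    rowOf : Matrix Carrier r r → Maybe (Fin r) → Vector Carrier r
    rowOf G (just a) b = G a b
    rowOf G nothing  b = 0#

    indicator : Fin r → Maybe (Fin r) → Carrier
    indicator a (just b) = scalar 1# a b
    indicator a nothing  = 0#

    -- The factor U of the overview. The factor V is `collect`, and `count` is the diagonal of W,
    -- that is, the sizes of the classes as ring elements.
    spread : Matrix Carrier r r → Matrix Carrier N r
    spread G i = rowOf G (f i)

    collect : Matrix Carrier r N
    collect a i = indicator a (f i)

    count : Fin r → Carrier
    count a = sum (collect a)

    spread⊗collect : ∀ G → spread G ⊗ collect ≋ blowUp G
    spread⊗collect G i j = lemma (f i) (f j)
      where
      lemma : ∀ s t → sum (λ b → rowOf G s b * indicator b t) ≈ entry G s t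
      lemma (just a) (just b) = trans (sum-scalarʳ 1# b (G a)) (*-identityʳ _)
      lemma (just a) nothing  = sum-zero λ b → zeroʳ (G a b)
      lemma nothing  t        = sum-zero λ b → zeroˡ (indicator b t)

    indicator-* : ∀ (g : Vector Carrier r) (h : Maybe (Fin r) → Carrier) → (∀ a → h (just a) ≈ g a) →
      ∀ a s → indicator a s * h s ≈ indicator a s * g a
    indicator-* g h h≈g a nothing = trans (zeroˡ _) (sym (zeroˡ _))
    indicator-* g h h≈g a (just b) with a ≟ b
    ... | yes ≡.refl = *-congˡ (h≈g a)
    ... | no  _      = trans (zeroˡ _) (sym (zeroˡ _))

    -- On the indices of class `a` the function h ∘ f is constantly g a, and all other indices
    -- contribute 0. This is V U = W G in general form; it also evaluates the class sums of
    -- eigenvectors and of lifted vectors.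
    collect-sum : ∀ (g : Vector Carrier r) (h : Maybe (Fin r) → Carrier) → (∀ a → h (just a) ≈ g a) →
      ∀ a → sum (λ i → collect a i * h (f i)) ≈ count a * g a
    collect-sum g h h≈g a = trans (sum-cong λ i → indicator-* g h h≈g a (f i))
      (sym (*-distribʳ-sum (g a) (collect a)))

    collect⊗spread : ∀ G a b → (collect ⊗ spread G) a b ≈ count a * G a b
    collect⊗spread G a b = collect-sum (λ a → G a b) (λ s → rowOf G s b) (λ _ → refl) a

    det-blowUp : ∀ G x → x ^ r * det rawRing (scalar x ⊞ ⊟ blowUp G) ≈
                         x ^ N * det rawRing (scalar x ⊞ ⊟ (λ a b → count a * G a b))
    det-blowUp G x = begin
      x ^ r * det rawRing (scalar x ⊞ ⊟ blowUp G)
        ≈⟨ *-congˡ (det-cong {N} λ i j → +-congˡ {scalar x i j} (-‿cong (spread⊗collect G i j))) ⟨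
      x ^ r * det rawRing (scalar x ⊞ ⊟ (spread G ⊗ collect))
        ≈⟨ det-sylvester x (spread G) collect ⟩
      x ^ N * det rawRing (scalar x ⊞ ⊟ (collect ⊗ spread G))
        ≈⟨ *-congˡ (det-cong {r} λ a b → +-congˡ {scalar x a b} (-‿cong (collect⊗spread G a b))) ⟩
      x ^ N * det rawRing (scalar x ⊞ ⊟ (λ a b → count a * G a b)) ∎

  bipartite : ∀ {p q} → Matrix Carrier p q → Matrix Carrier (p +ℕ q) (p +ℕ q)
  bipartite B = block 𝟘 B (B ᵀ) 𝟘

  weight : ∀ p {q} → Carrier → Carrier → Fin (p +ℕ q) → Carrier
  weight p u v a = [ const u , const v ]′ (splitAt p a)

  -- The matrix is [x, -uB; -vBᵀ, x], and its Schur complement contains the two weights only through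
  -- u v. With u = l and v = k this product is n, and here the dependence on k disappears.
  det-bipartite : ∀ {p q} (B : Matrix Carrier p q) x u v →
    x ^ q * det rawRing (scalar x ⊞ ⊟ (λ a b → weight p {q} u v a * bipartite B a b)) ≈
    x ^ p * det rawRing (scalar (x * x) ⊞ ⊟ (λ i j → (u * v) * (B ᵀ ⊗ B) i j))
  det-bipartite {p} {q} B x u v = begin
    x ^ q * det rawRing (scalar x ⊞ ⊟ (λ a b → weight p {q} u v a * bipartite B a b))
      ≈⟨ *-congˡ (det-cong to-block) ⟩
    x ^ q * det rawRing (block (scalar x) A C (scalar x))
      ≈⟨ det-schur₂ x x A C ⟩
    x ^ p * det rawRing (scalar (x * x) ⊞ ⊟ (C ⊗ A))
      ≈⟨ *-congˡ (det-cong {q} λ i j → +-congˡ {scalar (x * x) i j} (-‿cong (C⊗A i j))) ⟩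
    x ^ p * det rawRing (scalar (x * x) ⊞ ⊟ (λ i j → (u * v) * (B ᵀ ⊗ B) i j)) ∎
    where
    A : Matrix Carrier p q
    A i j = - (u * B i j)
    C : Matrix Carrier q p
    C j i = - (v * B i j)
    to-block : scalar x ⊞ ⊟ (λ a b → weight p {q} u v a * bipartite B a b) ≋ block (scalar x) A C (scalar x)
    to-block a b with splitAt p a | splitAt p b | scalar-block p {q} x a b
    ... | inj₁ i | inj₁ j | eq = trans (+-cong eq (trans (-‿cong (zeroʳ u)) -0#≈0#)) (+-identityʳ _)
    ... | inj₁ i | inj₂ j | eq = trans (+-congʳ eq) (+-identityˡ _)
    ... | inj₂ i | inj₁ j | eq = trans (+-congʳ eq) (+-identityˡ _)
    ... | inj₂ i | inj₂ j | eq = trans (+-cong eq (trans (-‿cong (zeroʳ v)) -0#≈0#)) (+-identityʳ _)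
    C⊗A : C ⊗ A ≋ λ i j → (u * v) * (B ᵀ ⊗ B) i j
    C⊗A i j = begin
      sum (λ k → - (v * B k i) * - (u * B k j)) ≈⟨ sum-cong (λ k → begin
        - (v * B k i) * - (u * B k j)     ≈⟨ -‿distribˡ-* _ _ ⟨
        - ((v * B k i) * - (u * B k j))   ≈⟨ -‿cong (-‿distribʳ-* _ _) ⟨
        - - ((v * B k i) * (u * B k j))   ≈⟨ -‿involutive _ ⟩
        (v * B k i) * (u * B k j)         ≈⟨ interchange v _ u _ ⟩
        (v * u) * (B k i * B k j)         ≈⟨ *-congʳ (*-comm v u) ⟩
        (u * v) * (B k i * B k j)         ∎) ⟩
      sum (λ k → (u * v) * (B k i * B k j)) ≈⟨ *-distribˡ-sum (u * v) (λ k → B k i * B k j) ⟨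
      (u * v) * (B ᵀ ⊗ B) i j ∎

  ×-zeroʳ : ∀ k → k · 0# ≈ 0#
  ×-zeroʳ zero    = refl
  ×-zeroʳ (suc k) = trans (+-identityˡ _) (×-zeroʳ k)

  sum-remQuot : ∀ k q (g : Vector Carrier q) → sum (λ i → g (proj₂ (remQuot {k} q i))) ≈ k · sum g
  sum-remQuot zero    q g = refl
  sum-remQuot (suc k) q g = begin
    sum (λ i → g (proj₂ (remQuot {suc k} q i)))
      ≈⟨ sum-cong (λ i → pointwise i) ⟩
    sum (λ i → [ g , (λ j → g (proj₂ (remQuot {k} q j))) ]′ (splitAt q i))
      ≈⟨ sum-splitAt q g (λ j → g (proj₂ (remQuot {k} q j))) ⟩
    sum g + sum (λ j → g (proj₂ (remQuot {k} q j)))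
      ≈⟨ +-congˡ (sum-remQuot k q g) ⟩
    suc k · sum g ∎
    where
    pointwise : ∀ i → g (proj₂ (remQuot {suc k} q i)) ≈ [ g , (λ j → g (proj₂ (remQuot {k} q j))) ]′ (splitAt q i)
    pointwise i with splitAt q i
    ... | inj₁ _ = refl
    ... | inj₂ _ = refl

  module _ (p q n k : ℕ) .{{_ : NonZero k}} .{{_ : NonZero (n / k)}} where

    private
      l : ℕ
      l = n / k

    count-class : ∀ a → count (class p q n k) a ≈ weight p {q} (l · 1#) (k · 1#) a
    count-class a = begin
      sum (λ i → indicator (class p q n k) a (class p q n k i))
        ≈⟨ sum-cong outer ⟩
      sum (λ i → [ h ∘ position p q k l , const 0# ]′ (splitAt (sizeF p q k l) i))
        ≈⟨ sum-splitAt (sizeF p q k l) (h ∘ position p q k l) (const {B = Fin (padding p q n k)} 0#) ⟩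
      sum (λ i → h (position p q k l i)) + sum {padding p q n k} (const 0#)
        ≈⟨ trans (+-congˡ (sum-zero {padding p q n k} λ _ → refl)) (+-identityʳ _) ⟩
      sum (λ i → h (position p q k l i))
        ≈⟨ sum-cong middle ⟩
      sum (λ i → [ h ∘ inj₁ , h′ ]′ (splitAt p i))
        ≈⟨ sum-splitAt p (h ∘ inj₁) h′ ⟩
      sum (h ∘ inj₁) + sum h′
        ≈⟨ +-congˡ (trans (sum-splitAt (k *ℕ q) hq hp)
             (+-cong (sum-remQuot k q (h ∘ inj₂)) (sum-remQuot (l ∸ 1) p (h ∘ inj₁)))) ⟩
      sum (h ∘ inj₁) + (k · sum (h ∘ inj₂) + (l ∸ 1) · sum (h ∘ inj₁))
        -- The leading block of size p and the l - 1 trailing ones make l copies; as l is nonzero, l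
        -- ∸ 1 is not truncated.
        ≈⟨ trans (x+[y+z]≈y+[x+z] _ _ _) (+-congˡ (reflexive (≡.cong (_· sum (h ∘ inj₁)) (ℕ.suc-pred l)))) ⟩
      k · sum (h ∘ inj₂) + l · sum (h ∘ inj₁)
        ≈⟨ evaluate (splitAt p a) sum-h₁ sum-h₂ ⟩
      weight p (l · 1#) (k · 1#) a ∎
      where
      h : Fin p ⊎ Fin q → Carrier
      h s = scalar 1# a (join p q s)
      hq : Vector Carrier (k *ℕ q)
      hq j = h (inj₂ (proj₂ (remQuot {k} q j)))
      hp : Vector Carrier ((l ∸ 1) *ℕ p)
      hp j = h (inj₁ (proj₂ (remQuot {l ∸ 1} p j)))
      h′ : Vector Carrier (k *ℕ q +ℕ (l ∸ 1) *ℕ p)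
      h′ j = [ hq , hp ]′ (splitAt (k *ℕ q) j)
      sum-row : ∀ {m} (i : Fin m) → sum (scalar 1# i) ≈ 1#
      sum-row {m} i = trans (sum-cong {f = scalar 1# i} λ j → sym (*-identityʳ _))
        (trans (sum-scalarˡ {m} 1# i (const 1#)) (*-identityʳ 1#))
      sum-h₁ : sum (h ∘ inj₁) ≈ [ const 1# , const 0# ]′ (splitAt p a)
      sum-h₁ = trans (sum-cong λ x → trans (scalar-block p 1# a (x ↑ˡ q)) (reflexive (h₁ x))) (total (splitAt p a))
        where
        h₁ : ∀ x → block (scalar {p} 1#) 𝟘 𝟘 (scalar {q} 1#) a (x ↑ˡ q) ≡ [ (λ i → scalar 1# i x) , const 0# ]′ (splitAt p a)
        h₁ x rewrite splitAt-↑ˡ p x q = ≡.refl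
        total : ∀ s → sum (λ x → [ (λ i → scalar 1# i x) , const 0# ]′ s) ≈ [ const 1# , const {B = Fin q} 0# ]′ s
        total (inj₁ i) = sum-row i
        total (inj₂ i) = sum-zero {p} λ _ → refl
      sum-h₂ : sum (h ∘ inj₂) ≈ [ const 0# , const 1# ]′ (splitAt p a)
      sum-h₂ = trans (sum-cong λ y → trans (scalar-block p 1# a (p ↑ʳ y)) (reflexive (h₂ y))) (total (splitAt p a))
        where
        h₂ : ∀ y → block (scalar {p} 1#) 𝟘 𝟘 (scalar {q} 1#) a (p ↑ʳ y) ≡ [ const 0# , (λ i → scalar 1# i y) ]′ (splitAt p a)
        h₂ y rewrite splitAt-↑ʳ p q y = ≡.refl
        total : ∀ s → sum (λ y → [ const 0# , (λ i → scalar 1# i y) ]′ s) ≈ [ const {B = Fin p} 0# , const 1# ]′ s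
        total (inj₁ i) = sum-zero {q} λ _ → refl
        total (inj₂ i) = sum-row i
      evaluate : ∀ s {u v} → u ≈ [ const 1# , const 0# ]′ s → v ≈ [ const 0# , const 1# ]′ s →
        k · v + l · u ≈ [ const {B = Fin p} (l · 1#) , const {B = Fin q} (k · 1#) ]′ s
      evaluate (inj₁ _) u≈ v≈ = trans (+-cong (trans (×-congʳ k v≈) (×-zeroʳ k)) (×-congʳ l u≈)) (+-identityˡ _)
      evaluate (inj₂ _) u≈ v≈ = trans (+-cong (×-congʳ k v≈) (trans (×-congʳ l u≈) (×-zeroʳ l))) (+-identityʳ _)
      outer : ∀ i → indicator (class p q n k) a (class p q n k i) ≈
                    [ h ∘ position p q k l , const 0# ]′ (splitAt (sizeF p q k l) i)
      outer i with splitAt (sizeF p q k l) i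
      ... | inj₁ _ = refl
      ... | inj₂ _ = refl
      middle : ∀ i → h (position p q k l i) ≈ [ h ∘ inj₁ , h′ ]′ (splitAt p i)
      middle i with splitAt p i
      ... | inj₁ _ = refl
      ... | inj₂ j with splitAt (k *ℕ q) j
      ...   | inj₁ _ = refl
      ...   | inj₂ _ = refl

    module _ {c′ ℓ₁ ℓ₂} (K : Field c′ ℓ₁ ℓ₂) (B : Matrix (Field.Carrier K) p q) (φ : Field.Carrier K → Carrier)
             (φ-0 : φ (Field.0# K) ≈ 0#) where

      -- Two maps `φ` are intended: the embedding of K into L, for eigenvectors, and the embedding
      -- followed by constant polynomials, for characteristic polynomials.
      F⊕0-blowUp : mapᴹ φ (F⊕0 K B n k) ≋ blowUp (class p q n k) (bipartite (mapᴹ φ B))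
      F⊕0-blowUp i j with splitAt (sizeF p q k l) i | splitAt (sizeF p q k l) j
      ... | inj₂ _ | inj₂ _ = φ-0
      ... | inj₁ _ | inj₂ _ = φ-0
      ... | inj₂ _ | inj₁ _ = φ-0
      ... | inj₁ i | inj₁ j with position p q k l i | position p q k l j
      ...   | inj₁ x | inj₁ y rewrite splitAt-↑ˡ p x q | splitAt-↑ˡ p y q = φ-0
      ...   | inj₁ x | inj₂ y rewrite splitAt-↑ˡ p x q | splitAt-↑ʳ p q y = refl
      ...   | inj₂ x | inj₁ y rewrite splitAt-↑ʳ p q x | splitAt-↑ˡ p y q = refl
      ...   | inj₂ x | inj₂ y rewrite splitAt-↑ʳ p q x | splitAt-↑ʳ p q y = φ-0

    det-F⊕0 : n ≡ l *ℕ k → ∀ (B : Matrix Carrier p q) x →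
      x ^ q * (x ^ (p +ℕ q) * det rawRing (scalar x ⊞ ⊟ blowUp (class p q n k) (bipartite B))) ≈
      x ^ (sizeF p q k l +ℕ padding p q n k) *
        (x ^ p * det rawRing (scalar (x * x) ⊞ ⊟ (λ i j → (n · 1#) * (B ᵀ ⊗ B) i j)))
    det-F⊕0 n≡lk B x = begin
      x ^ q * (x ^ (p +ℕ q) * det rawRing (scalar x ⊞ ⊟ blowUp (class p q n k) (bipartite B)))
        ≈⟨ *-congˡ (det-blowUp (class p q n k) (bipartite B) x) ⟩
      x ^ q * (x ^ N * det rawRing (scalar x ⊞ ⊟ (λ a b → count (class p q n k) a * bipartite B a b)))
        ≈⟨ x∙yz≈y∙xz _ _ _ ⟩
      x ^ N * (x ^ q * det rawRing (scalar x ⊞ ⊟ (λ a b → count (class p q n k) a * bipartite B a b)))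
        ≈⟨ *-congˡ (*-congˡ (det-cong {p +ℕ q} λ a b →
             +-congˡ {scalar x a b} (-‿cong (*-congʳ {bipartite B a b} (count-class a))))) ⟩
      x ^ N * (x ^ q * det rawRing (scalar x ⊞ ⊟ (λ a b → weight p {q} (l · 1#) (k · 1#) a * bipartite B a b)))
        ≈⟨ *-congˡ (det-bipartite B x (l · 1#) (k · 1#)) ⟩
      x ^ N * (x ^ p * det rawRing (scalar (x * x) ⊞ ⊟ (λ i j → ((l · 1#) * (k · 1#)) * (B ᵀ ⊗ B) i j)))
        ≈⟨ *-congˡ (*-congˡ (det-cong {q} λ i j → +-congˡ {scalar (x * x) i j}
             (-‿cong (*-congʳ {(B ᵀ ⊗ B) i j} (lk≈n))))) ⟩
      x ^ N * (x ^ p * det rawRing (scalar (x * x) ⊞ ⊟ (λ i j → (n · 1#) * (B ᵀ ⊗ B) i j))) ∎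
      where
      N : ℕ
      N = sizeF p q k l +ℕ padding p q n k
      lk≈n : (l · 1#) * (k · 1#) ≈ n · 1#
      lk≈n = trans (sym (×1-homo-* l k)) (reflexive (≡.cong (_· 1#) (≡.sym n≡lk)))

-- Eigenvectors over a field with apartness.

module Eigenvalues {c ℓ₁ ℓ₂} (L : Field c ℓ₁ ℓ₂) where
  open Field L using (commutativeRing; heytingCommutativeRing; _#_; #⇒invertible; #-cotrans; #-irrefl; tight)
  open CommutativeRing commutativeRing hiding (zero)
  open MatrixRing commutativeRing
  open BlowUp commutativeRing
  open import Algebra.Apartness.Properties.HeytingCommutativeRing heytingCommutativeRing
    using (invertibleˡ⇒#; x-0≈x; 1#0; x#0y#0→xy#0; #-congʳ)
  open import Algebra.Properties.Ring ring using (-‿distribʳ-*; -1*x≈-x)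
  open import Algebra.Properties.CommutativeSemigroup *-commutativeSemigroup using (x∙yz≈y∙xz)
  open import Relation.Binary.Reasoning.Setoid setoid

  -- Apartness from 0 is invertibility, and if z inverts x y, then z y inverts x.
  x*y#0⇒x#0 : ∀ {x y} → x * y # 0# → x # 0#
  x*y#0⇒x#0 {x} {y} xy#0 with #⇒invertible xy#0
  ... | z , z*xy≈1 , _ = invertibleˡ⇒# (z * y , (begin
    z * y * (x - 0#)    ≈⟨ *-congˡ (x-0≈x x) ⟩
    z * y * x           ≈⟨ *-assoc z y x ⟩
    z * (y * x)         ≈⟨ *-congˡ (*-comm y x) ⟩
    z * (x * y)         ≈⟨ *-congˡ (x-0≈x (x * y)) ⟨
    z * (x * y - 0#)    ≈⟨ z*xy≈1 ⟩
    1#                  ∎))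

  x*y#0⇒y#0 : ∀ {x y} → x * y # 0# → y # 0#
  x*y#0⇒y#0 {x} {y} xy#0 = x*y#0⇒x#0 (#-congʳ (*-comm x y) xy#0)

  -- Cotransitivity with y as the third point: either y is apart from 0, or x + y is apart from y,
  -- and then their difference x is invertible.
  x+y#0⇒x#0⊎y#0 : ∀ {x y} → x + y # 0# → x # 0# ⊎ y # 0#
  x+y#0⇒x#0⊎y#0 {x} {y} x+y#0 with #-cotrans x+y#0 y
  ... | inj₂ y#0 = inj₂ y#0
  ... | inj₁ x+y#y with #⇒invertible x+y#y
  ...   | z , z*≈1 , _ = inj₁ (invertibleˡ⇒# (z , (begin
    z * (x - 0#)       ≈⟨ *-congˡ (x-0≈x x) ⟩
    z * x              ≈⟨ *-congˡ (+-identityʳ x) ⟨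
    z * (x + 0#)       ≈⟨ *-congˡ (+-congˡ (-‿inverseʳ y)) ⟨
    z * (x + (y - y))  ≈⟨ *-congˡ (+-assoc x y (- y)) ⟨
    z * (x + y - y)    ≈⟨ z*≈1 ⟩
    1#                 ∎)))

  sum#0 : ∀ {n} (f : Vector Carrier n) → sum f # 0# → ∃[ i ] f i # 0#
  sum#0 {zero}  f 0#0 = contradiction 0#0 (#-irrefl refl)
  sum#0 {suc n} f f#0 with x+y#0⇒x#0⊎y#0 f#0
  ... | inj₁ f₀#0 = zero , f₀#0
  ... | inj₂ fₛ#0 with sum#0 (f ∘ suc) fₛ#0
  ...   | i , fᵢ#0 = suc i , fᵢ#0

  y#0⇒x≈0 : ∀ {x y} → x * y ≈ 0# → y # 0# → x ≈ 0#
  y#0⇒x≈0 {x} xy≈0 y#0 = proj₁ (tight x 0#) λ x#0 → #-irrefl xy≈0 (x#0y#0→xy#0 x#0 y#0)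

  eigenvalue-cong : ∀ {n} {A A′ : Matrix Carrier n n} {e e′} → A ≋ A′ → e ≈ e′ →
    IsEigenvalue L A e → IsEigenvalue L A′ e′
  eigenvalue-cong A≋A′ e≈e′ (v , v#0 , Av≈ev) = v , v#0 , λ i →
    trans (sum-cong λ j → *-congʳ (sym (A≋A′ i j))) (trans (Av≈ev i) (*-congʳ e≈e′))

  ⊗-apply : ∀ {m n o} (A : Matrix Carrier m n) (C : Matrix Carrier n o) (v : Vector Carrier o) i →
    sum (λ j → (A ⊗ C) i j * v j) ≈ sum (λ b → A i b * sum (λ j → C b j * v j))
  ⊗-apply A C v i = begin
    sum (λ j → sum (λ b → A i b * C b j) * v j)   ≈⟨ sum-cong (λ j → *-distribʳ-sum (v j) (λ b → A i b * C b j)) ⟩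
    sum (λ j → sum (λ b → A i b * C b j * v j))   ≈⟨ ∑-comm (λ j b → A i b * C b j * v j) ⟩
    sum (λ b → sum (λ j → A i b * C b j * v j))   ≈⟨ sum-cong (λ b → trans (sum-cong λ j → *-assoc (A i b) (C b j) (v j))
                                                       (sym (*-distribˡ-sum (A i b) (λ j → C b j * v j)))) ⟩
    sum (λ b → A i b * sum (λ j → C b j * v j))   ∎

  sum-scale : ∀ {n} x (g h : Vector Carrier n) → sum (λ b → g b * (x * h b)) ≈ x * sum (λ b → g b * h b)
  sum-scale x g h = trans (sum-cong λ b → x∙yz≈y∙xz (g b) x (h b)) (sym (*-distribˡ-sum x λ b → g b * h b))

  module _ {N r} (f : Fin N → Maybe (Fin r)) (G : Matrix Carrier r r) where

    blowUp-apply : ∀ (v : Vector Carrier N) i →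
      sum (λ j → blowUp f G i j * v j) ≈ sum (λ b → spread f G i b * sum (λ j → collect f b j * v j))
    blowUp-apply v i = trans (sum-cong λ j → *-congʳ (sym (spread⊗collect f G i j))) (⊗-apply (spread f G) (collect f) v i)

    -- With more indices than classes, some column is zero or two columns are equal. A unit vector
    -- or a difference of two unit vectors is then in the kernel.
    blowUp-zero-eigenvalue : Fin r → r < N → IsEigenvalue L (blowUp f G) 0#
    -- Indices outside all classes are sent to the arbitrary class `a`. A collision due to this
    -- default does no harm: it involves such an index, and the column there is zero.
    blowUp-zero-eigenvalue a r<N with pigeonhole r<N (λ i → fromMaybe a (f i))
    ... | i , j , i<j , eq = pick (f i) ≡.refl (f j) ≡.refl eq
      where
      i≢j : i ≢ j
      i≢j = <⇒≢ i<j
      column : ∀ m j → sum (λ o → blowUp f G m o * scalar 1# o j) ≈ blowUp f G m j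
      column m j = trans (sum-scalarʳ 1# j (blowUp f G m)) (*-identityʳ _)
      entry-nothing : ∀ s → entry f G s nothing ≈ 0#
      entry-nothing (just _) = refl
      entry-nothing nothing  = refl
      unit-vector : ∀ j → f j ≡ nothing → IsEigenvalue L (blowUp f G) 0#
      unit-vector j fj≡ = (λ o → scalar 1# o j) , (j , #-congʳ (sym (reflexive (scalar-diagonal 1# j))) 1#0) ,
        λ m → trans (column m j) (trans (reflexive (≡.cong (entry f G (f m)) fj≡))
          (trans (entry-nothing (f m)) (sym (zeroˡ _))))
      difference : f i ≡ f j → IsEigenvalue L (blowUp f G) 0#
      difference fi≡fj = v , (i , #-congʳ vi≈1 1#0) , λ m → begin
        sum (λ o → blowUp f G m o * v o)
          ≈⟨ sum-cong (λ o → distribˡ (blowUp f G m o) (scalar 1# o i) (- 1# * scalar 1# o j)) ⟩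
        sum (λ o → blowUp f G m o * scalar 1# o i + blowUp f G m o * (- 1# * scalar 1# o j))
          ≈⟨ ∑-distrib-+ (λ o → blowUp f G m o * scalar 1# o i) (λ o → blowUp f G m o * (- 1# * scalar 1# o j)) ⟩
        sum (λ o → blowUp f G m o * scalar 1# o i) + sum (λ o → blowUp f G m o * (- 1# * scalar 1# o j))
          ≈⟨ +-cong (column m i) (trans (sum-scale (- 1#) (blowUp f G m) (λ o → scalar 1# o j))
               (trans (*-congˡ (column m j)) (-1*x≈-x _))) ⟩
        blowUp f G m i - blowUp f G m j
          ≈⟨ +-congʳ (reflexive (≡.cong (entry f G (f m)) fi≡fj)) ⟩
        blowUp f G m j - blowUp f G m j
          ≈⟨ -‿inverseʳ _ ⟩
        0#
          ≈⟨ zeroˡ (v m) ⟨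
        0# * v m ∎
        where
        v : Vector Carrier N
        v o = scalar 1# o i + - 1# * scalar 1# o j
        vi≈1 : 1# ≈ v i
        vi≈1 = sym (trans (+-cong (reflexive (scalar-diagonal 1# i))
          (trans (*-congˡ (reflexive (scalar-off-diagonal 1# i≢j))) (zeroʳ _))) (+-identityʳ 1#))
      pick : ∀ s → f i ≡ s → ∀ t → f j ≡ t → fromMaybe a (f i) ≡ fromMaybe a (f j) → IsEigenvalue L (blowUp f G) 0#
      pick nothing  fi≡ _        _   _  = unit-vector i fi≡
      pick (just _) _   nothing  fj≡ _  = unit-vector j fj≡
      pick (just x) fi≡ (just y) fj≡ eq = difference (≡.trans fi≡ (≡.trans (≡.cong just x≡y) (≡.sym fj≡)))
        where
        x≡y : x ≡ y
        x≡y = ≡.trans (≡.cong (fromMaybe a) (≡.sym fi≡)) (≡.trans eq (≡.cong (fromMaybe a) fj≡))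

    -- The equation W G s = e s without the condition that s be nonzero, since V v satisfies it even
    -- when it is not known to be nonzero.
    IsQuotientEigenvector : (Fin r → Carrier) → Carrier → Vector Carrier r → Set ℓ₁
    IsQuotientEigenvector w e s = ∀ a → w a * sum (λ b → G a b * s b) ≈ e * s a

    module _ {w : Fin r → Carrier} (count≈w : ∀ a → count f a ≈ w a) where

      module Collected {e} {v : Vector Carrier N} (eigen : ∀ i → sum (λ j → blowUp f G i j * v j) ≈ e * v i) where

        collected : Vector Carrier r
        collected a = sum (λ j → collect f a j * v j)

        spread-collected : ∀ i → sum (λ b → spread f G i b * collected b) ≈ e * v i
        spread-collected i = trans (sym (blowUp-apply v i)) (eigen i)

        collected-eigen : IsQuotientEigenvector w e collected
        collected-eigen a = begin
          w a * sum (λ b → G a b * collected b)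
            ≈⟨ *-congʳ (count≈w a) ⟨
          count f a * sum (λ b → G a b * collected b)
            ≈⟨ collect-sum f (λ a → sum (λ b → G a b * collected b))
                 (λ s → sum (λ b → rowOf f G s b * collected b)) (λ _ → refl) a ⟨
          sum (λ i → collect f a i * sum (λ b → spread f G i b * collected b))
            ≈⟨ sum-cong (λ i → *-congˡ (spread-collected i)) ⟩
          sum (λ i → collect f a i * (e * v i))
            ≈⟨ sum-scale e (collect f a) v ⟩
          e * collected a ∎

      -- Since V U = W G, the cube of U V is U (W G)² V, and (W G)² = (W G W) G vanishes by
      -- hypothesis. Hence e³ v = 0, and tightness turns the impossibility of e # 0 into e ≈ 0.
      blowUp-nilpotent : (∀ a b → w a * (G a b * w b) ≈ 0#) → ∀ {e} → IsEigenvalue L (blowUp f G) e → e ≈ 0#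
      blowUp-nilpotent wGw≈0 {e} (v , (i , vi#0) , eigen) = proj₁ (tight e 0#) λ e#0 →
        #-irrefl e³v≈0 (x#0y#0→xy#0 e#0 (x#0y#0→xy#0 e#0 (x#0y#0→xy#0 e#0 vi#0)))
        where
        open Collected {e} {v} eigen
        s : Vector Carrier r
        s = collected
        e²s≈0 : ∀ a → e * (e * s a) ≈ 0#
        e²s≈0 a = begin
          e * (e * s a)                                    ≈⟨ *-congˡ (collected-eigen a) ⟨
          e * (w a * sum (λ b → G a b * s b))              ≈⟨ x∙yz≈y∙xz _ _ _ ⟩
          w a * (e * sum (λ b → G a b * s b))              ≈⟨ *-congˡ (sum-scale e (G a) s) ⟨
          w a * sum (λ b → G a b * (e * s b))              ≈⟨ *-congˡ (sum-cong λ b → *-congˡ (collected-eigen b)) ⟨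
          w a * sum (λ b → G a b * (w b * t b))            ≈⟨ *-distribˡ-sum (w a) (λ b → G a b * (w b * t b)) ⟩
          sum (λ b → w a * (G a b * (w b * t b)))          ≈⟨ sum-zero {f = λ b → w a * (G a b * (w b * t b))} (λ b → begin
            w a * (G a b * (w b * t b))   ≈⟨ *-congˡ (*-assoc _ _ _) ⟨
            w a * (G a b * w b * t b)     ≈⟨ *-assoc _ _ _ ⟨
            w a * (G a b * w b) * t b     ≈⟨ *-congʳ (wGw≈0 a b) ⟩
            0# * t b                      ≈⟨ zeroˡ _ ⟩
            0#                            ∎) ⟩
          0# ∎
          where
          t : Fin r → Carrier
          t b = sum (λ d → G b d * s d)
        e³v≈0 : e * (e * (e * v i)) ≈ 0#
        e³v≈0 = begin
          e * (e * (e * v i))                              ≈⟨ *-congˡ (*-congˡ (spread-collected i)) ⟨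
          e * (e * sum (λ b → spread f G i b * s b))       ≈⟨ *-congˡ (sum-scale e (spread f G i) s) ⟨
          e * sum (λ b → spread f G i b * (e * s b))       ≈⟨ sum-scale e (spread f G i) (λ b → e * s b) ⟨
          sum (λ b → spread f G i b * (e * (e * s b)))     ≈⟨ sum-zero (λ b → trans (*-congˡ (e²s≈0 b)) (zeroʳ _)) ⟩
          0#                                               ∎

      module _ (w#0 : ∀ a → w a # 0#) where

        inverse : Fin r → Carrier
        inverse a = proj₁ (#⇒invertible (w#0 a))

        inverse-* : ∀ a → inverse a * w a ≈ 1#
        inverse-* a = trans (*-congˡ (sym (x-0≈x (w a)))) (proj₁ (proj₂ (#⇒invertible (w#0 a))))

        -- The value s a is shared equally among the w a members of its class, so that collecting
        -- the lifted vector returns s.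
        lift : Vector Carrier r → Maybe (Fin r) → Carrier
        lift s (just a) = inverse a * s a
        lift s nothing  = 0#

        -- Row a of W G s = e s, divided by w a, reads U s = e (lift s) at every index of class a.
        spread-lift : ∀ {e s} → IsQuotientEigenvector w e s →
          ∀ t → sum (λ b → rowOf f G t b * s b) ≈ e * lift s t
        spread-lift {e} {s} ws nothing = trans (sum-zero λ b → zeroˡ (s b)) (sym (zeroʳ e))
        spread-lift {e} {s} ws (just a) = begin
          sum (λ b → G a b * s b)                        ≈⟨ *-identityˡ _ ⟨
          1# * sum (λ b → G a b * s b)                   ≈⟨ *-congʳ (inverse-* a) ⟨
          inverse a * w a * sum (λ b → G a b * s b)      ≈⟨ *-assoc _ _ _ ⟩
          inverse a * (w a * sum (λ b → G a b * s b))    ≈⟨ *-congˡ (ws a) ⟩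
          inverse a * (e * s a)                          ≈⟨ x∙yz≈y∙xz _ _ _ ⟩
          e * (inverse a * s a)                          ∎

        collect-lift : ∀ s a → sum (λ i → collect f a i * lift s (f i)) ≈ s a
        collect-lift s a = begin
          sum (λ i → collect f a i * lift s (f i))  ≈⟨ collect-sum f (λ a → inverse a * s a) (lift s) (λ _ → refl) a ⟩
          count f a * (inverse a * s a)             ≈⟨ *-assoc _ _ _ ⟨
          count f a * inverse a * s a               ≈⟨ *-congʳ (trans (*-congʳ (count≈w a)) (trans (*-comm _ _) (inverse-* a))) ⟩
          1# * s a                                  ≈⟨ *-identityˡ _ ⟩
          s a                                       ∎

        lift-eigenvalue : ∀ {e s} → IsQuotientEigenvector w e s → (∃[ a ] s a # 0#) → IsEigenvalue L (blowUp f G) e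
        lift-eigenvalue {e} {s} ws (a , sa#0) = (λ i → lift s (f i)) , nonzero , λ i → begin
          sum (λ j → blowUp f G i j * lift s (f j))
            ≈⟨ blowUp-apply (λ j → lift s (f j)) i ⟩
          sum (λ b → spread f G i b * sum (λ j → collect f b j * lift s (f j)))
            ≈⟨ sum-cong (λ b → *-congˡ (collect-lift s b)) ⟩
          sum (λ b → spread f G i b * s b)
            ≈⟨ spread-lift ws (f i) ⟩
          e * lift s (f i) ∎
          where
          nonzero : ∃[ i ] lift s (f i) # 0#
          -- A suitable member of class `a` is extracted from the class sum s a, which is apart from
          -- 0; no index has to be located in the block layout.
          nonzero with sum#0 (λ i → collect f a i * lift s (f i)) (#-congʳ (sym (collect-lift s a)) sa#0)
          ... | i , t#0 = i , x*y#0⇒y#0 t#0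

        -- v is the lift of its collected vector plus a remainder on which e acts as zero.
        collect-eigenvalue : ∀ {e} → IsEigenvalue L (blowUp f G) e →
          (∃[ s ] IsQuotientEigenvector w e s × (∃[ a ] s a # 0#)) ⊎ e ≈ 0#
        collect-eigenvalue {e} (v , (i , vi#0) , eigen) with x+y#0⇒x#0⊎y#0 (#-congʳ (decompose (v i) (lift collected (f i))) vi#0)
          where
          open Collected {e} {v} eigen
          decompose : ∀ x y → x ≈ y + (x - y)
          decompose x y = begin
            x              ≈⟨ +-identityʳ x ⟨
            x + 0#         ≈⟨ +-congˡ (-‿inverseʳ y) ⟨
            x + (y - y)    ≈⟨ +-assoc x y (- y) ⟨
            x + y - y      ≈⟨ +-congʳ (+-comm x y) ⟩
            y + x - y      ≈⟨ +-assoc y x (- y) ⟩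
            y + (x - y)    ∎
        ... | inj₁ lift#0 = inj₁ (collected , collected-eigen , component (f i) lift#0)
          where
          open Collected {e} {v} eigen
          component : ∀ t → lift collected t # 0# → ∃[ a ] collected a # 0#
          component (just a) t#0 = a , x*y#0⇒y#0 t#0
          component nothing  t#0 = contradiction t#0 (#-irrefl refl)
        ... | inj₂ u#0 = inj₂ (y#0⇒x≈0 (begin
          e * (v i - lift collected (f i))          ≈⟨ distribˡ e _ _ ⟩
          e * v i + e * - lift collected (f i)      ≈⟨ +-congˡ (-‿distribʳ-* e _) ⟨
          e * v i - e * lift collected (f i)        ≈⟨ +-congˡ (-‿cong (trans
            (sym (spread-lift {e} {collected} collected-eigen (f i))) (spread-collected i))) ⟩
          e * v i - e * v i                         ≈⟨ -‿inverseʳ _ ⟩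
          0#                                        ∎) u#0)
          where
          open Collected {e} {v} eigen

    -- By hypothesis Γ = diag γ satisfies W′ G Γ = Γ W G, so it carries solutions of W G s = e s to
    -- solutions for W′ G with the same e.
    quotient-rescale : ∀ {w w′ γ : Fin r → Carrier} → (∀ a b → w′ a * (G a b * γ b) ≈ γ a * (w a * G a b)) →
      ∀ {e s} → IsQuotientEigenvector w e s → IsQuotientEigenvector w′ e (λ a → γ a * s a)
    quotient-rescale {w} {w′} {γ} scaling {e} {s} ws a = begin
      w′ a * sum (λ b → G a b * (γ b * s b))       ≈⟨ *-distribˡ-sum (w′ a) (λ b → G a b * (γ b * s b)) ⟩
      sum (λ b → w′ a * (G a b * (γ b * s b)))     ≈⟨ sum-cong (λ b → begin
        w′ a * (G a b * (γ b * s b))    ≈⟨ *-congˡ (*-assoc _ _ _) ⟨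
        w′ a * (G a b * γ b * s b)      ≈⟨ *-assoc _ _ _ ⟨
        w′ a * (G a b * γ b) * s b      ≈⟨ *-congʳ (scaling a b) ⟩
        γ a * (w a * G a b) * s b       ≈⟨ *-assoc _ _ _ ⟩
        γ a * (w a * G a b * s b)       ≈⟨ *-congˡ (*-assoc _ _ _) ⟩
        γ a * (w a * (G a b * s b))     ∎) ⟩
      sum (λ b → γ a * (w a * (G a b * s b)))      ≈⟨ *-distribˡ-sum (γ a) (λ b → w a * (G a b * s b)) ⟨
      γ a * sum (λ b → w a * (G a b * s b))        ≈⟨ *-congˡ (*-distribˡ-sum (w a) (λ b → G a b * s b)) ⟨
      γ a * (w a * sum (λ b → G a b * s b))        ≈⟨ *-congˡ (ws a) ⟩
      γ a * (e * s a)                              ≈⟨ x∙yz≈y∙xz _ _ _ ⟩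
      e * (γ a * s a)                              ∎

-- The common size of the padded matrices.

-- The subtractions in `padding` are exact: after cancelling one q it is l(k - 1)p - (k - 1)q, which
-- is not negative because l ≥ 1 and q ≤ p. The resulting size is free of k, which gives all
-- divisors the same power of X.
total-size : ∀ p q n k .{{_ : NonZero n}} .{{_ : NonZero k}} → q ≤ p → k ∣ n →
  sizeF p q k (n / k) +ℕ padding p q n k ≡ n *ℕ p +ℕ q
total-size p q n k q≤p k∣n = helper k (n / k) (m/n*n≡m k∣n)
  where
  open ≡.≡-Reasoning
  helper : ∀ k l .{{_ : NonZero k}} → l *ℕ k ≡ n →
    sizeF p q k l +ℕ (((n ∸ l) *ℕ p +ℕ q) ∸ k *ℕ q) ≡ n *ℕ p +ℕ q
  helper k       zero    0≡n    = contradiction (≡.sym 0≡n) (≢-nonZero⁻¹ n)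
  helper (suc k) (suc l) ≡.refl = begin
    p +ℕ ((q +ℕ k *ℕ q) +ℕ l *ℕ p) +ℕ ((suc l *ℕ suc k ∸ suc l) *ℕ p +ℕ q ∸ (q +ℕ k *ℕ q))
      ≡⟨ ≡.cong (p +ℕ ((q +ℕ k *ℕ q) +ℕ l *ℕ p) +ℕ_) pad ⟩
    p +ℕ ((q +ℕ k *ℕ q) +ℕ l *ℕ p) +ℕ (m ∸ k *ℕ q)
      ≡⟨ solve 5 (λ p q kq r lp → p :+ ((q :+ kq) :+ lp) :+ r := p :+ lp :+ q :+ (r :+ kq)) ≡.refl
           p q (k *ℕ q) (m ∸ k *ℕ q) (l *ℕ p) ⟩
    p +ℕ l *ℕ p +ℕ q +ℕ (m ∸ k *ℕ q +ℕ k *ℕ q)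
      ≡⟨ ≡.cong (p +ℕ l *ℕ p +ℕ q +ℕ_) (ℕ.m∸n+n≡m kq≤m) ⟩
    p +ℕ l *ℕ p +ℕ q +ℕ m
      ≡⟨ solve 4 (λ p q k l → p :+ l :* p :+ q :+ (con 1 :+ l) :* k :* p := (con 1 :+ l) :* (con 1 :+ k) :* p :+ q) ≡.refl p q k l ⟩
    suc l *ℕ suc k *ℕ p +ℕ q ∎
    where
    open +-*-Solver
    m : ℕ
    m = suc l *ℕ k *ℕ p
    kq≤m : k *ℕ q ≤ m
    kq≤m = ℕ.*-mono-≤ (ℕ.m≤m+n k (l *ℕ k)) q≤p
    pad : (suc l *ℕ suc k ∸ suc l) *ℕ p +ℕ q ∸ (q +ℕ k *ℕ q) ≡ m ∸ k *ℕ q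
    pad = begin
      (suc l *ℕ suc k ∸ suc l) *ℕ p +ℕ q ∸ (q +ℕ k *ℕ q)
        ≡⟨ ≡.cong (λ z → (z ∸ suc l) *ℕ p +ℕ q ∸ (q +ℕ k *ℕ q)) (ℕ.*-suc (suc l) k) ⟩
      (suc l +ℕ suc l *ℕ k ∸ suc l) *ℕ p +ℕ q ∸ (q +ℕ k *ℕ q)
        ≡⟨ ≡.cong (λ z → z *ℕ p +ℕ q ∸ (q +ℕ k *ℕ q)) (ℕ.m+n∸m≡n (suc l) (suc l *ℕ k)) ⟩
      m +ℕ q ∸ (q +ℕ k *ℕ q)
        ≡⟨ ≡.cong (_∸ (q +ℕ k *ℕ q)) (ℕ.+-comm m q) ⟩
      q +ℕ m ∸ (q +ℕ k *ℕ q)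
        ≡⟨ ℕ.[m+n]∸[m+o]≡n∸o q m (k *ℕ q) ⟩
      m ∸ k *ℕ q ∎

nonZero-quotient : ∀ n k .{{_ : NonZero n}} .{{_ : NonZero k}} → k ∣ n → NonZero (n / k)
nonZero-quotient n k k∣n = ≢-nonZero λ n/k≡0 → ≢-nonZero⁻¹ n
  (≡.trans (≡.sym (m/n*n≡m k∣n)) (≡.cong (_*ℕ k) n/k≡0))

-- Independence of the characteristic determinant from k.

module _ {c ℓ} (S : CommutativeRing c ℓ) where
  open CommutativeRing S hiding (zero)
  open MatrixRing S
  open BlockMatrix S
  open BlowUp S
  open import Algebra.Properties.Semiring.Mult semiring using () renaming (_×_ to _·_)

  ^-cancelˡ : ∀ {x} → (∀ g h → x * g ≈ x * h → g ≈ h) → ∀ m g h → x ^ m * g ≈ x ^ m * h → g ≈ h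
  ^-cancelˡ     cancel zero    g h eq = trans (sym (*-identityˡ g)) (trans eq (*-identityˡ h))
  ^-cancelˡ {x} cancel (suc m) g h eq = ^-cancelˡ cancel m g h (cancel (x ^ m * g) (x ^ m * h)
    (trans (sym (*-assoc x (x ^ m) g)) (trans eq (*-assoc x (x ^ m) h))))

  module _ {c′ ℓ₁ ℓ₂} (K : Field c′ ℓ₁ ℓ₂) (n p q : ℕ) .{{_ : NonZero n}} (q≤p : q ≤ p)
           (B : Matrix (Field.Carrier K) p q) (φ : Field.Carrier K → Carrier) (φ-0 : φ (Field.0# K) ≈ 0#) where

    det-F⊕0-closed : ∀ x k .{{_ : NonZero k}} → k ∣ n →
      x ^ q * (x ^ (p +ℕ q) * det rawRing (scalar x ⊞ ⊟ mapᴹ φ (F⊕0 K B n k))) ≈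
      x ^ (n *ℕ p +ℕ q) *
        (x ^ p * det rawRing (scalar (x * x) ⊞ ⊟ (λ i j → (n · 1#) * (mapᴹ φ B ᵀ ⊗ mapᴹ φ B) i j)))
    det-F⊕0-closed x k k∣n = trans
      (*-congˡ (*-congˡ (det-cong {N} λ i j → +-congˡ {scalar x i j} (-‿cong (F⊕0-blowUp p q n k K B φ φ-0 i j)))))
      (trans (det-F⊕0 p q n k (≡.sym (m/n*n≡m k∣n)) (mapᴹ φ B) x)
        (*-congʳ (reflexive (≡.cong (x ^_) (total-size p q n k q≤p k∣n)))))
      where
      instance
        l≢0 : NonZero (n / k)
        l≢0 = nonZero-quotient n k k∣n
      N : ℕ
      N = sizeF p q k (n / k) +ℕ padding p q n k

    det-F⊕0-unique : ∀ x → (∀ g h → x * g ≈ x * h → g ≈ h) →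
      ∀ k k′ .{{_ : NonZero k}} .{{_ : NonZero k′}} → k ∣ n → k′ ∣ n →
      det rawRing (scalar x ⊞ ⊟ mapᴹ φ (F⊕0 K B n k)) ≈ det rawRing (scalar x ⊞ ⊟ mapᴹ φ (F⊕0 K B n k′))
    det-F⊕0-unique x cancel k k′ k∣n k′∣n = ^-cancelˡ cancel (p +ℕ q) _ _ (^-cancelˡ cancel q _ _
      (trans (det-F⊕0-closed x k k∣n) (sym (det-F⊕0-closed x k′ k′∣n))))

-- Transfer of multiplicities and eigenvalues between two divisors.

module _ {c ℓ₁ ℓ₂} {K L : Field c ℓ₁ ℓ₂} (φ : Extension K L) (n p q : ℕ)
         .{{_ : NonZero n}} .{{_ : NonZero p}} (q≤p : q ≤ p) (B : Matrix (Field.Carrier K) p q) where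
  open Extension φ
  open IsRingHomomorphism isRingHomomorphism using (0#-homo)
  open Field L using (commutativeRing; _#_; ℕ-zero-or-apart; _·_)

  -- Over the polynomial ring of L, with x = X and the entries as constants, `det-F⊕0-unique` is the
  -- equality of the two characteristic polynomials, so the same cofactor `g` serves both.
  multiplicity-transfer : ∀ k k′ .{{_ : NonZero k}} .{{_ : NonZero k′}} → k ∣ n → k′ ∣ n → ∀ e m →
    HasMultiplicity L (mapᴹ embed (F⊕0 K B n k)) e m → HasMultiplicity L (mapᴹ embed (F⊕0 K B n k′)) e m
  multiplicity-transfer k k′ k∣n k′∣n e m (g , χ≈ , g#0) = g , (λ i → trans (χ≈χ′ i) (χ≈ i)) , g#0
    where
    open CommutativeRing commutativeRing using (rawRing; refl; trans)
    open PolynomialRing commutativeRing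
    open Polynomial rawRing using (X) renaming (const to constᴾ)
    χ≈χ′ : charPoly L (mapᴹ embed (F⊕0 K B n k′)) ≈ᴾ charPoly L (mapᴹ embed (F⊕0 K B n k))
    χ≈χ′ = det-F⊕0-unique polynomialRing K n p q q≤p B (λ x → constᴾ (embed x))
      (λ { zero → 0#-homo ; (suc _) → refl }) X X-cancelˡ k′ k k′∣n k∣n

  module _ where
    open CommutativeRing commutativeRing hiding (zero)
    open BlowUp commutativeRing
    open Eigenvalues L
    open import Algebra.Apartness.Properties.HeytingCommutativeRing (Field.heytingCommutativeRing L) using (#-congʳ; x#0y#0→xy#0)
    open import Algebra.Properties.Semiring.Mult semiring using (×1-homo-*)
    open import Algebra.Properties.CommutativeSemigroup *-commutativeSemigroup using (x∙yz≈y∙xz)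
    open import Relation.Binary.Reasoning.Setoid setoid

    private
      G : Matrix Carrier (p +ℕ q) (p +ℕ q)
      G = bipartite (mapᴹ embed B)

      mult : ℕ → Carrier
      mult m = m · 1#

    factor : ∀ k .{{_ : NonZero k}} → k ∣ n → mult (n / k) * mult k ≈ mult n
    factor k k∣n = trans (sym (×1-homo-* (n / k) k)) (reflexive (≡.cong mult (m/n*n≡m k∣n)))

    l#0 : mult n # 0# → ∀ k .{{_ : NonZero k}} → k ∣ n → mult (n / k) # 0#
    l#0 n#0 k k∣n = x*y#0⇒x#0 (#-congʳ (sym (factor k k∣n)) n#0)

    k#0 : mult n # 0# → ∀ k .{{_ : NonZero k}} → k ∣ n → mult k # 0#
    k#0 n#0 k k∣n = x*y#0⇒y#0 (#-congʳ (sym (factor k k∣n)) n#0)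

    weight#0 : ∀ {u v} → u # 0# → v # 0# → ∀ a → weight p {q} u v a # 0#
    weight#0 u#0 v#0 a with splitAt p a
    ... | inj₁ _ = u#0
    ... | inj₂ _ = v#0

    -- Entries inside the diagonal blocks of G are zero, and an entry outside them meets one weight
    -- u and one weight v. Hence W G W = u v G.
    bipartite-vanish : ∀ {u v} → u * v ≈ 0# → ∀ a b → weight p u v a * (G a b * weight p u v b) ≈ 0#
    bipartite-vanish {u} {v} uv≈0 a b with splitAt p a | splitAt p b
    ... | inj₁ i | inj₁ j = trans (*-congˡ (zeroˡ u)) (zeroʳ u)
    ... | inj₁ i | inj₂ j = trans (x∙yz≈y∙xz _ _ _) (trans (*-congˡ uv≈0) (zeroʳ _))
    ... | inj₂ i | inj₁ j = trans (x∙yz≈y∙xz _ _ _) (trans (*-congˡ (trans (*-comm v u) uv≈0)) (zeroʳ _))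
    ... | inj₂ i | inj₂ j = trans (*-congˡ (zeroˡ v)) (zeroʳ v)

    -- Origin of γ = (u′, u): intertwining requires u′ γ₂ = γ₁ u on the block B, which this choice
    -- satisfies. The block Bᵀ then requires v′ u′ = u v, the hypothesis.
    bipartite-rescale : ∀ {u v u′ v′} → u * v ≈ u′ * v′ → ∀ a b →
      weight p u′ v′ a * (G a b * weight p u′ u b) ≈ weight p u′ u a * (weight p u v a * G a b)
    bipartite-rescale {u} {v} {u′} {v′} uv≈u′v′ a b with splitAt p a | splitAt p b
    ... | inj₁ i | inj₁ j = *-congˡ (trans (zeroˡ _) (sym (zeroʳ _)))
    ... | inj₁ i | inj₂ j = *-congˡ (*-comm _ _)
    ... | inj₂ j | inj₁ i = begin
      v′ * (embed (B i j) * u′)   ≈⟨ x∙yz≈y∙xz _ _ _ ⟩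
      embed (B i j) * (v′ * u′)   ≈⟨ *-congˡ (trans (*-comm v′ u′) (sym uv≈u′v′)) ⟩
      embed (B i j) * (u * v)     ≈⟨ *-comm _ _ ⟩
      u * v * embed (B i j)       ≈⟨ *-assoc _ _ _ ⟩
      u * (v * embed (B i j))     ∎
    ... | inj₂ i | inj₂ j = trans (trans (*-congˡ (zeroˡ _)) (zeroʳ _)) (sym (trans (*-congˡ (zeroʳ _)) (zeroʳ _)))

    eigenvalue-transfer : ∀ k k′ .{{_ : NonZero k}} .{{_ : NonZero k′}} → k ∣ n → k′ ∣ n → 2 ≤ n → ∀ {e} →
      IsEigenvalue L (mapᴹ embed (F⊕0 K B n k)) e → IsEigenvalue L (mapᴹ embed (F⊕0 K B n k′)) e
    eigenvalue-transfer k k′ k∣n k′∣n 2≤n {e} eig = eigenvalue-cong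
      {A = blowUp (class p q n k′) G} {mapᴹ embed (F⊕0 K B n k′)} {e}
      (λ i j → sym (F⊕0-blowUp p q n k′ K B embed 0#-homo i j)) refl
      (transfer (eigenvalue-cong {A = mapᴹ embed (F⊕0 K B n k)} {blowUp (class p q n k) G} {e}
        (F⊕0-blowUp p q n k K B embed 0#-homo) refl eig))
      where
      instance
        l≢0 : NonZero (n / k)
        l≢0 = nonZero-quotient n k k∣n
        l′≢0 : NonZero (n / k′)
        l′≢0 = nonZero-quotient n k′ k′∣n
      0<p : 0 < p
      0<p = >-nonZero⁻¹ p
      -- Strictness uses n ≥ 2 and p > 0. For n = 1 every class has exactly one index, and the
      -- pigeonhole argument has nothing to work with.
      p+q<np+q : p +ℕ q < n *ℕ p +ℕ q
      p+q<np+q = ℕ.+-monoˡ-< q (ℕ.<-≤-trans (ℕ.m<m+n p 0<p)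
        (ℕ.≤-trans (ℕ.≤-reflexive (≡.cong (p +ℕ_) (≡.sym (ℕ.+-identityʳ p)))) (ℕ.*-monoˡ-≤ p 2≤n)))
      zero-eigenvalue : e ≈ 0# → IsEigenvalue L (blowUp (class p q n k′) G) e
      zero-eigenvalue e≈0 = eigenvalue-cong {A = blowUp (class p q n k′) G} (λ _ _ → refl) (sym e≈0)
        (blowUp-zero-eigenvalue (class p q n k′) G (fromℕ< (ℕ.<-≤-trans 0<p (ℕ.m≤m+n p q)))
        (ℕ.<-≤-trans p+q<np+q (ℕ.≤-reflexive (≡.sym (total-size p q n k′ q≤p k′∣n)))))
      w w′ γ : Fin (p +ℕ q) → Carrier
      w  = weight p {q} (mult (n / k)) (mult k)
      w′ = weight p {q} (mult (n / k′)) (mult k′)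
      γ  = weight p {q} (mult (n / k′)) (mult (n / k))
      lifted : mult n # 0# →
        (∃[ s ] IsQuotientEigenvector (class p q n k) G w e s × (∃[ a ] s a # 0#)) →
        IsEigenvalue L (blowUp (class p q n k′) G) e
      lifted n#0 (s , ws , a , sa#0) = lift-eigenvalue (class p q n k′) G {w′} (count-class p q n k′)
        (weight#0 (l#0 n#0 k′ k′∣n) (k#0 n#0 k′ k′∣n)) {e} {λ a → γ a * s a}
        (quotient-rescale (class p q n k′) G {w} {w′} {γ}
          (bipartite-rescale (trans (factor k k∣n) (sym (factor k′ k′∣n)))) {e} {s} ws)
        (a , x#0y#0→xy#0 (weight#0 (l#0 n#0 k′ k′∣n) (l#0 n#0 k k∣n) a) sa#0)
      transfer : IsEigenvalue L (blowUp (class p q n k) G) e → IsEigenvalue L (blowUp (class p q n k′) G) e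
      transfer eig =
        [ (λ n≈0 → zero-eigenvalue (blowUp-nilpotent (class p q n k) G {w} (count-class p q n k)
            (bipartite-vanish (trans (factor k k∣n) n≈0)) {e} eig))
        , (λ n#0 → [ lifted n#0 , zero-eigenvalue ]′ (collect-eigenvalue (class p q n k) G {w} (count-class p q n k)
            (weight#0 (l#0 n#0 k k∣n) (k#0 n#0 k k∣n)) {e} eig))
        -- The characteristic of L may divide n. If it does not, the weights l, k, l′ and k′ are all
        -- invertible, being factors of n.
        ]′ (ℕ-zero-or-apart n)

theorem3p5 : ∀ {c ℓ₁ ℓ₂} (K : Field c ℓ₁ ℓ₂) (n p q : ℕ)
    .{{_ : NonZero n}} .{{_ : NonZero p}} .{{_ : NonZero q}} →
    q ≤ p → (B : Matrix (Field.Carrier K) p q) →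
    (k k′ : ℕ) .{{_ : NonZero k}} .{{_ : NonZero k′}} → k ∣ n → k′ ∣ n →
    Cospectral K (F⊕0 K B n k) (F⊕0 K B n k′)
theorem3p5 K n p q q≤p B k k′ k∣n k′∣n L φ e with k ℕ.≟ k′
-- Equal divisors are split off because n = 1 leaves only k = k′ = 1, and there 0 need not be an
-- eigenvalue: take p = q and B invertible.
... | yes ≡.refl = mk⇔ id id , λ _ → mk⇔ id id
... | no k≢k′    =
    mk⇔ (eigenvalue-transfer φ n p q q≤p B k k′ k∣n k′∣n 2≤n)
        (eigenvalue-transfer φ n p q q≤p B k′ k k′∣n k∣n 2≤n)
  , λ m → mk⇔ (multiplicity-transfer φ n p q q≤p B k k′ k∣n k′∣n e m)
              (multiplicity-transfer φ n p q q≤p B k′ k k′∣n k∣n e m)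
  where
  2≤n : 2 ≤ n
  2≤n = ℕ.≤∧≢⇒< (>-nonZero⁻¹ n) λ { ≡.refl → k≢k′ (≡.trans (∣1⇒≡1 k∣n) (≡.sym (∣1⇒≡1 k′∣n))) }
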